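{- Let $K$ be a field, let $X$ be a set and let $A$ be a ring of functions $X\to K$ containing the constant functions and such that every $f\in A$ without zeroes in $X$ is a unit in $A$. Suppose one of the following conditions holds: (a) $K$ is not algebraically closed; or (b) $K$ is the algebraic closure of a real closed field $R$ and $A$ is closed under the conjugation of $K=R[i]$; or (c) $K$ is a topological field of characteristic $\ne2$, where a basis of neighborhoods of $0\in K$ is given by the non-zero ideals of a ring $\mathcal O$ with fraction field $K$ and non-zero Jacobson radical, and moreover $w\circ(f,g)\in A$ for all $f,g\in A$ and every continuous function $w:K^2\to K$ that is definable in $(K,\mathcal O)$. Then the following conditions are equivalent for all $f_1,\dots,f_n,g\in A$: (1) $\{f_1=0\}\cap\dots\cap\{f_n=0\}\subseteq\{g=0\}$. (2) $g\in\operatorname{Jac}(f_1,\dots,f_n)$. (3) For all $h\in A$, the element $1+hg$ is a unit modulo the ideal $(f_1,\dots,f_n)$. Consequently, the $(n+1)$-ary relation $\{f_1=0\}\cap\dots\cap\{f_n=0\}\subseteq\{g=0\}$ on $A$ is definable in the ring $A$ by the formula of the language of rings $$\forall x\,\exists y_1,\dots,y_n,z\ \ (1+x\cdot g)\cdot z=1+y_1f_1+\dots+y_nf_n.$$ In particular (case $n=1$), the binary relation $f\sqsubseteq g$, defined as $\{f=0\}\subseteq\{g=0\}$, is $0$-definable in $A$.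
   Context: For a function $f:X\to K$, $\{f=0\}=\{x\in X: f(x)=0\}$. A ring of functions $X\to K$ is a (unital) subring of $K^X$ with pointwise operations. For an ideal $I$ of a commutative ring $A$, the Jacobson radical $\operatorname{Jac}(I)$ is the intersection of all maximal ideals of $A$ containing $I$; the Jacobson radical of a ring is $\operatorname{Jac}(0)$; $\operatorname{Jac}(f_1,\dots,f_n)$ denotes $\operatorname{Jac}$ of the ideal generated by $f_1,\dots,f_n$. Closed under conjugation in (b) means that $x\mapsto f(x)^*$ is in $A$ whenever $f\in A$, where $^*$ is the complex conjugation of $R[i]$ over $R$. $(K,\mathcal O)$ is the field $K$ expanded by a predicate for the subset $\mathcal O$; definable means with parameters. -}

module Defs where

open import Level using (Level; Lift) renaming (suc to lsuc)
open import Algebra.Bundles using (CommutativeRing; RawRing; Semiring)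
import Algebra.Construct.Pointwise as Pointwise
import Algebra.Definitions.RawMonoid as RawMonoidDefs
import Algebra.Definitions.RawSemiring as RawSemiringDefs
import Algebra.Morphism.RingMonomorphism as RingMono
open import Algebra.Morphism.Structures using (IsRingHomomorphism; IsRingMonomorphism)
open import Data.Empty using (⊥)
open import Data.Fin.Base using (Fin; zero; suc; toℕ; fromℕ; _↑ˡ_; _↑ʳ_)
open import Data.Nat.Base using (ℕ; zero; suc)
import Data.Nat.Base as ℕ
open import Data.Product.Base using (Σ-syntax; ∃; ∃-syntax; ∃₂; _×_; _,_; proj₁; proj₂)
open import Data.Product.Relation.Binary.Pointwise.NonDependent using (_×ₛ_)
open import Data.Sum.Base using (_⊎_)
open import Data.Unit.Base using (⊤)
open import Data.Vec.Functional using (Vector; []; _∷_; foldl)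
open import Function.Base using (_∘_; const; id)
open import Function.Bundles using (_⇔_; Func)
open import Relation.Binary.Bundles using (Setoid)
import Relation.Binary.Construct.On as On
open import Relation.Nullary using (¬_)
open import Relation.Unary using (Pred; _∈_; _⊆_; _≐_; _∩_; ⋃; ⋂; _⊢_; _⟨×⟩_)
open import Relation.Binary.Definitions using (_Respects_)

module _ {ℓ : Level} (R : CommutativeRing ℓ ℓ) where
  open CommutativeRing R
  open RawMonoidDefs +-rawMonoid using (sum)

  record IsField : Set ℓ where
    field
      0≉1     : ¬ 0# ≈ 1#
      inverse : ∀ x → ¬ x ≈ 0# → ∃[ y ] x * y ≈ 1#

  IsUnit : Pred Carrier ℓ
  IsUnit u = ∃[ v ] u * v ≈ 1#

  record IsIdeal (I : Pred Carrier ℓ) : Set ℓ where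
    field
      resp     : I Respects _≈_
      0∈       : 0# ∈ I
      +-closed : ∀ {x y} → x ∈ I → y ∈ I → x + y ∈ I
      *-closed : ∀ r {x} → x ∈ I → r * x ∈ I

  -- Ideals are predicates at level ℓ; in the presence of excluded middle this
  -- is no restriction, every subset being given by a decidable predicate.
  record IsMaximalIdeal (M : Pred Carrier ℓ) : Set (lsuc ℓ) where
    field
      isIdeal : IsIdeal M
      proper  : ¬ 1# ∈ M
      maximal : ∀ J → IsIdeal J → M ⊆ J → ¬ 1# ∈ J → J ⊆ M

  -- The ideal generated by f₁, …, fₙ.
  ⟨_⟩ : ∀ {n} → Vector Carrier n → Pred Carrier ℓ
  ⟨_⟩ {n} f g = Σ[ a ∈ Vector Carrier n ] g ≈ sum (λ i → a i * f i)

  IsUnitModulo : Pred Carrier ℓ → Pred Carrier ℓ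
  IsUnitModulo I u = ∃[ v ] (u * v - 1#) ∈ I

  Jac : Pred Carrier ℓ → Pred Carrier (lsuc ℓ)
  Jac I x = ∀ M → IsMaximalIdeal M → I ⊆ M → x ∈ M

  JacobsonRadical : Pred Carrier (lsuc ℓ)
  JacobsonRadical = Jac (_≈ 0#)

record Subring {ℓ : Level} (R : CommutativeRing ℓ ℓ) : Set (lsuc ℓ) where
  open CommutativeRing R hiding (rawRing)
  field
    contains : Pred Carrier ℓ
    resp     : contains Respects _≈_
    0∈       : 0# ∈ contains
    1∈       : 1# ∈ contains
    +-closed : ∀ {x y} → x ∈ contains → y ∈ contains → x + y ∈ contains
    *-closed : ∀ {x y} → x ∈ contains → y ∈ contains → x * y ∈ contains
    -‿closed : ∀ {x} → x ∈ contains → - x ∈ contains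

  rawRing : RawRing ℓ ℓ
  rawRing = record
    { Carrier = ∃ contains
    ; _≈_     = λ x y → proj₁ x ≈ proj₁ y
    ; _+_     = λ x y → proj₁ x + proj₁ y , +-closed (proj₂ x) (proj₂ y)
    ; _*_     = λ x y → proj₁ x * proj₁ y , *-closed (proj₂ x) (proj₂ y)
    ; -_      = λ x → - proj₁ x , -‿closed (proj₂ x)
    ; 0#      = 0# , 0∈
    ; 1#      = 1# , 1∈
    }

  inclusion-isRingMonomorphism :
    IsRingMonomorphism rawRing (CommutativeRing.rawRing R) proj₁
  inclusion-isRingMonomorphism = record
    { isRingHomomorphism = record
      { isSemiringHomomorphism = record
        { isNearSemiringHomomorphism = record
          { +-isMonoidHomomorphism = record
            { isMagmaHomomorphism = record
              { isRelHomomorphism = record { cong = id }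
              ; homo = λ _ _ → refl
              }
            ; ε-homo = refl
            }
          ; *-homo = λ _ _ → refl
          }
        ; 1#-homo = refl
        }
      ; -‿homo = λ _ → refl
      }
    ; injective = id
    }

  commutativeRing : CommutativeRing ℓ ℓ
  commutativeRing = record
    { isCommutativeRing =
        RingMono.isCommutativeRing inclusion-isRingMonomorphism isCommutativeRing }

  image : Pred (∃ contains) ℓ → Pred Carrier ℓ
  image I x = Σ[ x∈ ∈ x ∈ contains ] (x , x∈) ∈ I

module _ {ℓ : Level} (K : CommutativeRing ℓ ℓ) where
  open CommutativeRing K
  open RawMonoidDefs +-rawMonoid using (sum)
  open RawSemiringDefs (Semiring.rawSemiring semiring) using (_^_)

  -- A vector p stands for the polynomial p₀ + p₁ X + … + pₙ Xⁿ.
  HasDegree : ∀ n → Vector Carrier (suc n) → Set ℓ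
  HasDegree n p = ¬ p (fromℕ n) ≈ 0#

  eval : ∀ {n} → Vector Carrier n → Carrier → Carrier
  eval p x = sum (λ i → p i * x ^ toℕ i)

  AlgebraicallyClosed : Set ℓ
  AlgebraicallyClosed =
    ∀ n (p : Vector Carrier (suc (suc n))) → HasDegree (suc n) p →
    ∃[ x ] eval p x ≈ 0#

  record IsRealClosed : Set ℓ where
    field
      isField      : IsField K
      formallyReal : ∀ {n} (v : Vector Carrier n) → ¬ sum (λ i → v i * v i) ≈ - 1#
      squareRoots  : ∀ a → ∃[ b ] (b * b ≈ a ⊎ b * b ≈ - a)
      oddRoots     : ∀ k (p : Vector Carrier (suc (1 ℕ.+ 2 ℕ.* k))) →
                   HasDegree (1 ℕ.+ 2 ℕ.* k) p → ∃[ x ] eval p x ≈ 0#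

record IsAlgebraicClosure {ℓ : Level} (R K : CommutativeRing ℓ ℓ)
  (ι : CommutativeRing.Carrier R → CommutativeRing.Carrier K) : Set ℓ where
  private
    module R = CommutativeRing R
    module K = CommutativeRing K
  field
    isRingHomomorphism  : IsRingHomomorphism R.rawRing K.rawRing ι
    algebraicallyClosed : AlgebraicallyClosed K
    algebraic           : ∀ z → ∃₂ λ n (p : Vector R.Carrier (suc n)) →
                          HasDegree R n p × eval K (ι ∘ p) z K.≈ K.0#

-- K is the algebraic closure of R and, equivalently, K = R[i].  Both are
-- recorded: the coordinates a + b i are what conjugation is defined from.
-- They are unique because -1 is not a square in R.
record RealClosedSubfieldWithClosure {ℓ : Level} (K : CommutativeRing ℓ ℓ) : Set (lsuc ℓ) where
  open CommutativeRing K
  field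
    R                  : CommutativeRing ℓ ℓ
    isRealClosed       : IsRealClosed R
    ι                  : CommutativeRing.Carrier R → Carrier
    isAlgebraicClosure : IsAlgebraicClosure R K ι
    i                  : Carrier
    i²≈-1              : i * i ≈ - 1#
    K≈R[i]             : ∀ z → ∃₂ λ a b → z ≈ ι a + ι b * i

  conj : Carrier → Carrier
  conj z = let (a , b , _) = K≈R[i] z in ι a - ι b * i

record Topology {ℓ : Level} (S : Setoid ℓ ℓ) : Set (lsuc (lsuc ℓ)) where
  open Setoid S
  field
    IsOpen : Pred Carrier ℓ → Set (lsuc ℓ)
    resp-≐ : IsOpen Respects _≐_
    resp-≈ : ∀ {V} → IsOpen V → V Respects _≈_
    U-open : IsOpen (λ _ → Lift ℓ ⊤)
    ∩-open : ∀ {V W} → IsOpen V → IsOpen W → IsOpen (V ∩ W)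
    ⋃-open : ∀ (I : Set ℓ) (V : I → Pred Carrier ℓ) →
             (∀ j → IsOpen (V j)) → IsOpen (⋃ I V)

  IsNeighbourhood : Carrier → Pred Carrier ℓ → Set (lsuc ℓ)
  IsNeighbourhood x N = ∃[ V ] (IsOpen V × x ∈ V × V ⊆ N)

module _ {ℓ : Level} where
  open Topology

  productTopology : {S T : Setoid ℓ ℓ} → Topology S → Topology T → Topology (S ×ₛ T)
  productTopology 𝒮 𝒯 = record
    { IsOpen = λ Q → ∀ p → p ∈ Q → ∃₂ λ V W →
        IsOpen 𝒮 V × IsOpen 𝒯 W × p ∈ (V ⟨×⟩ W) × (V ⟨×⟩ W) ⊆ Q
    ; resp-≐ = λ (Q⊆Q′ , Q′⊆Q) Q-open p p∈Q′ →
        let V , W , oV , oW , p∈ , ⊆Q = Q-open p (Q′⊆Q p∈Q′)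
        in V , W , oV , oW , p∈ , λ q∈ → Q⊆Q′ (⊆Q q∈)
    ; resp-≈ = λ Q-open {p} (p₁≈ , p₂≈) p∈Q →
        let _ , _ , oV , oW , (p₁∈ , p₂∈) , ⊆Q = Q-open p p∈Q
        in ⊆Q (resp-≈ 𝒮 oV p₁≈ p₁∈ , resp-≈ 𝒯 oW p₂≈ p₂∈)
    ; U-open = λ p _ → _ , _ , U-open 𝒮 , U-open 𝒯 , _ , _
    ; ∩-open = λ Q-open Q′-open p (p∈Q , p∈Q′) →
        let _ , _ , oV , oW , (p₁∈ , p₂∈) , ⊆Q = Q-open p p∈Q
            _ , _ , oV′ , oW′ , (p₁∈′ , p₂∈′) , ⊆Q′ = Q′-open p p∈Q′
        in _ , _ , ∩-open 𝒮 oV oV′ , ∩-open 𝒯 oW oW′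
         , ((p₁∈ , p₁∈′) , (p₂∈ , p₂∈′))
         , λ ((q₁∈ , q₁∈′) , (q₂∈ , q₂∈′)) → ⊆Q (q₁∈ , q₂∈) , ⊆Q′ (q₁∈′ , q₂∈′)
    ; ⋃-open = λ I Q Q-open p (j , p∈) →
        let V , W , oV , oW , p∈VW , ⊆Q = Q-open j p p∈
        in V , W , oV , oW , p∈VW , λ q∈ → j , ⊆Q q∈
    }

  subspaceSetoid : (S : Setoid ℓ ℓ) → Pred (Setoid.Carrier S) ℓ → Setoid ℓ ℓ
  subspaceSetoid S P = On.setoid {B = ∃ P} S proj₁

  subspaceTopology : {S : Setoid ℓ ℓ} → Topology S →
    (P : Pred (Setoid.Carrier S) ℓ) → Topology (subspaceSetoid S P)
  subspaceTopology 𝒮 P = record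
    { IsOpen = λ Q → ∃[ V ] (IsOpen 𝒮 V × Q ≐ proj₁ ⊢ V)
    ; resp-≐ = λ (Q⊆Q′ , Q′⊆Q) (V , oV , Q⊆V , V⊆Q) →
        V , oV , (λ q → Q⊆V (Q′⊆Q q)) , λ v → Q⊆Q′ (V⊆Q v)
    ; resp-≈ = λ (V , oV , Q⊆V , V⊆Q) x≈y x∈Q → V⊆Q (resp-≈ 𝒮 oV x≈y (Q⊆V x∈Q))
    ; U-open = _ , U-open 𝒮 , _ , _
    ; ∩-open = λ (V , oV , Q⊆V , V⊆Q) (V′ , oV′ , Q′⊆V′ , V′⊆Q′) →
        _ , ∩-open 𝒮 oV oV′
          , (λ (q , q′) → Q⊆V q , Q′⊆V′ q′) , λ (v , v′) → V⊆Q v , V′⊆Q′ v′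
    ; ⋃-open = λ I Q Q-open →
        _ , ⋃-open 𝒮 I (proj₁ ∘ Q-open) (proj₁ ∘ proj₂ ∘ Q-open)
          , (λ (j , q) → j , proj₁ (proj₂ (proj₂ (Q-open j))) q)
          , λ (j , v) → j , proj₂ (proj₂ (proj₂ (Q-open j))) v
    }

  Continuous : {S T : Setoid ℓ ℓ} → Topology S → Topology T →
    (Setoid.Carrier S → Setoid.Carrier T) → Set (lsuc ℓ)
  Continuous 𝒮 𝒯 f = ∀ V → IsOpen 𝒯 V → IsOpen 𝒮 (f ⊢ V)

record IsTopologicalField {ℓ : Level} (K : CommutativeRing ℓ ℓ) (K-isField : IsField K)
  (𝒯 : Topology (CommutativeRing.setoid K)) : Set (lsuc ℓ) where
  open CommutativeRing K
  open IsField K-isField using (inverse)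

  NonZero : Pred Carrier ℓ
  NonZero x = ¬ x ≈ 0#

  field
    +-continuous : Continuous (productTopology 𝒯 𝒯) 𝒯 (λ (x , y) → x + y)
    *-continuous : Continuous (productTopology 𝒯 𝒯) 𝒯 (λ (x , y) → x * y)
    -‿continuous : Continuous 𝒯 𝒯 (λ x → - x)
    inverse-continuous :
      Continuous (subspaceTopology 𝒯 NonZero) 𝒯 (λ (x , x≉0) → proj₁ (inverse x x≉0))

-- Formulas in the language of rings expanded by unary predicate symbols from
-- S.  Variables are de Bruijn indices; a quantifier binds variable zero.

infixl 7 _·_
infixl 6 _⊕_
infix  5 _≐̇_
infixr 4 _∧_
infixr 3 _∨_
infixr 2 _⇒_

data Term (n : ℕ) : Set where
  var     : Fin n → Term n
  𝟎 𝟏     : Term n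
  _⊕_ _·_ : Term n → Term n → Term n
  ⊝_      : Term n → Term n

data Formula (S : Set) (n : ℕ) : Set where
  _≐̇_         : Term n → Term n → Formula S n
  pred        : S → Term n → Formula S n
  false       : Formula S n
  _∧_ _∨_ _⇒_ : Formula S n → Formula S n → Formula S n
  all ex      : Formula S (suc n) → Formula S n

ex^ : ∀ {S} k {n} → Formula S (k ℕ.+ n) → Formula S n
ex^ zero    φ = φ
ex^ (suc k) φ = ex^ k (ex φ)

module Semantics {ℓ : Level} (R : CommutativeRing ℓ ℓ) {S : Set}
  (⟦_⟧ᵖ : S → Pred (CommutativeRing.Carrier R) ℓ) where
  open CommutativeRing R

  ⟦_⟧ : ∀ {n} → Term n → Vector Carrier n → Carrier
  ⟦ var j ⟧ ρ = ρ j
  ⟦ 𝟎 ⟧     ρ = 0#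
  ⟦ 𝟏 ⟧     ρ = 1#
  ⟦ s ⊕ t ⟧ ρ = ⟦ s ⟧ ρ + ⟦ t ⟧ ρ
  ⟦ s · t ⟧ ρ = ⟦ s ⟧ ρ * ⟦ t ⟧ ρ
  ⟦ ⊝ t ⟧   ρ = - ⟦ t ⟧ ρ

  Sat : ∀ {n} → Formula S n → Vector Carrier n → Set ℓ
  Sat (s ≐̇ t)    ρ = ⟦ s ⟧ ρ ≈ ⟦ t ⟧ ρ
  Sat (pred P t) ρ = ⟦ t ⟧ ρ ∈ ⟦ P ⟧ᵖ
  Sat false      ρ = Lift ℓ ⊥
  Sat (φ ∧ ψ)    ρ = Sat φ ρ × Sat ψ ρ
  Sat (φ ∨ ψ)    ρ = Sat φ ρ ⊎ Sat ψ ρ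
  Sat (φ ⇒ ψ)    ρ = Sat φ ρ → Sat ψ ρ
  Sat (all φ)    ρ = ∀ a → Sat φ (a ∷ ρ)
  Sat (ex φ)     ρ = ∃[ a ] Sat φ (a ∷ ρ)

RingFormula : ℕ → Set
RingFormula = Formula ⊥

infix 3 _⊨_[_]

_⊨_[_] : ∀ {ℓ} (R : CommutativeRing ℓ ℓ) {n} → RingFormula n →
  Vector (CommutativeRing.Carrier R) n → Set ℓ
R ⊨ φ [ ρ ] = Semantics.Sat R (λ ()) φ ρ

0-Definable₂ : ∀ {ℓ} (R : CommutativeRing ℓ ℓ) →
  (CommutativeRing.Carrier R → CommutativeRing.Carrier R → Set ℓ) → Set ℓ
0-Definable₂ R _~_ =
  Σ[ φ ∈ RingFormula 2 ] ∀ a b → (R ⊨ φ [ a ∷ b ∷ [] ]) ⇔ (a ~ b)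

-- The free variables are g, f₁, …, fₙ (in this order).  In the matrix,
-- variable 0 is z, the next n are the yᵢ, followed by x, g, f₁, …, fₙ.
jacFormula : ∀ n → RingFormula (suc n)
jacFormula n = all (ex^ n (ex ((𝟏 ⊕ x · g) · z ≐̇ foldl _⊕_ 𝟏 (λ j → y j · f j))))
  where
  x g z : Term (suc (n ℕ.+ suc (suc n)))
  x = var (suc (n ↑ʳ zero))
  g = var (suc (n ↑ʳ suc zero))
  z = var zero
  y f : Fin n → Term (suc (n ℕ.+ suc (suc n)))
  y j = var (suc (j ↑ˡ suc (suc n)))
  f j = var (suc (n ↑ʳ suc (suc j)))

module _ {ℓ : Level} (K : CommutativeRing ℓ ℓ) where
  open CommutativeRing K

  -- The graph of w is defined in (K, 𝒪) by φ with parameters c.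
  IsDefinable₂ : Pred Carrier ℓ → (Carrier × Carrier → Carrier) → Set ℓ
  IsDefinable₂ 𝒪 w = ∃[ k ] Σ[ φ ∈ Formula ⊤ (3 ℕ.+ k) ] Σ[ c ∈ Vector Carrier k ]
    ∀ x y z → (w (x , y) ≈ z) ⇔ Semantics.Sat K (const 𝒪) φ (x ∷ y ∷ z ∷ c)

  IsFractionField : Subring K → Set ℓ
  IsFractionField 𝒪 = ∀ z → ∃₂ λ a b →
    a ∈ Subring.contains 𝒪 × b ∈ Subring.contains 𝒪 × ¬ b ≈ 0# × z * b ≈ a

  record IsNonZeroIdealOf (𝒪 : Subring K) (N : Pred Carrier ℓ) : Set (lsuc ℓ) where
    field
      ideal   : Pred (∃ (Subring.contains 𝒪)) ℓ
      isIdeal : IsIdeal (Subring.commutativeRing 𝒪) ideal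
      isImage : N ≐ Subring.image 𝒪 ideal
      nonZero : ∃[ x ] (x ∈ N × ¬ x ≈ 0#)

_^^_ : ∀ {ℓ} → CommutativeRing ℓ ℓ → Set ℓ → CommutativeRing ℓ ℓ
K ^^ X = Pointwise.commutativeRing X K

FunctionRing : ∀ {ℓ} → CommutativeRing ℓ ℓ → Set ℓ → Set (lsuc ℓ)
FunctionRing K X = Subring (K ^^ X)

module _ {ℓ : Level} (K : CommutativeRing ℓ ℓ) (X : Set ℓ) (A : FunctionRing K X) where
  open CommutativeRing K
  open Subring A using (contains; commutativeRing)
  private Aᶜ = CommutativeRing.Carrier commutativeRing

  ContainsConstants : Set ℓ
  ContainsConstants = ∀ c → const c ∈ contains

  Zeros : Aᶜ → Pred X ℓ
  Zeros f x = proj₁ f x ≈ 0#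

  ZeroFreeAreUnits : Set ℓ
  ZeroFreeAreUnits = ∀ f → (∀ x → ¬ x ∈ Zeros f) → IsUnit commutativeRing f

  ZerosIncluded : ∀ {n} → Vector Aᶜ n → Aᶜ → Set ℓ
  ZerosIncluded {n} f g = ⋂ (Fin n) (λ j → Zeros (f j)) ⊆ Zeros g

  _⊑_ : Aᶜ → Aᶜ → Set ℓ
  f ⊑ g = Zeros f ⊆ Zeros g

  ConditionA : Set ℓ
  ConditionA = ¬ AlgebraicallyClosed K

  record ConditionB : Set (lsuc ℓ) where
    field
      realClosed : RealClosedSubfieldWithClosure K
    open RealClosedSubfieldWithClosure realClosed
    field
      conj-closed : ∀ f → f ∈ contains → (conj ∘ f) ∈ contains

  record ConditionC (K-isField : IsField K) : Set (lsuc (lsuc ℓ)) where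
    field
      topology           : Topology setoid
      isTopologicalField : IsTopologicalField K K-isField topology
      char≢2             : ¬ 1# + 1# ≈ 0#
      𝒪                  : Subring K
      isFractionField    : IsFractionField K 𝒪

    open Topology topology
    open Subring 𝒪 using () renaming (contains to 𝒪-set; commutativeRing to 𝒪-ring)

    field
      ideal-isNeighbourhood : ∀ N → IsNonZeroIdealOf K 𝒪 N → IsNeighbourhood 0# N
      ideals-areBasis       : ∀ N → IsNeighbourhood 0# N →
                              ∃[ I ] (IsNonZeroIdealOf K 𝒪 I × I ⊆ N)
      Jac-nonZero           : ∃[ r ] (r ∈ JacobsonRadical 𝒪-ring × ¬ proj₁ r ≈ 0#)
      w-closed : (w : Func (setoid ×ₛ setoid) setoid) →
        Continuous (productTopology topology topology) topology (Func.to w) →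
        IsDefinable₂ K 𝒪-set (Func.to w) →
        ∀ f g → f ∈ contains → g ∈ contains → (λ x → Func.to w (f x , g x)) ∈ contains

-- The heart of the matter is (1) ⇒ (3).  In each of the cases (a)–(c) there are
-- α, β : K² → K under which A is closed such that α(x,y)x + β(x,y)y vanishes only
-- at the origin.  Hence every finitely generated ideal of A contains an element
-- whose zeros are the common zeros of the generators; applied to 1 + hg, f₁, …, fₙ,
-- which have no common zero, it yields a unit.  In case (a), αx + βy is the
-- homogenisation of a polynomial without roots; in case (b) it is x̄x + ȳy.  In
-- case (c), α = x and β = 0 if y ∈ x𝒪, and α = 0 and β = y otherwise: these are
-- continuous because the relation y ∈ x𝒪 is locally constant away from the origin,
-- 𝒪 not being a field.
--
-- (3) ⇒ (2) is elementary, and (2) ⇒ (1) holds because the functions vanishing at a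
-- given point form a maximal ideal.  Thus no maximal ideal has to be constructed by
-- Zorn's lemma.
module Submission where

open import Defs
open import Level using (Level; Lift; lift; lower) renaming (suc to lsuc)
open import Algebra.Bundles using (CommutativeRing)
open import Axiom.ExcludedMiddle using (ExcludedMiddle)
open import Data.Empty using (⊥; ⊥-elim)
open import Data.Fin.Base using (Fin; zero; suc; toℕ; fromℕ; _↑ˡ_; _↑ʳ_)
open import Data.Nat.Base as ℕ using (ℕ; zero; suc)
open import Data.Product.Base using (Σ-syntax; ∃; ∃-syntax; ∃₂; _×_; _,_; proj₁; proj₂)
open import Data.Product.Relation.Binary.Pointwise.NonDependent using (_×ₛ_)
open import Data.Sum.Base using (_⊎_; inj₁; inj₂)
open import Data.Unit.Base using (⊤; tt)
open import Data.Vec.Functional using (Vector; []; _∷_; foldl)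
open import Function.Base using (_∘_; const; _$_)
open import Function.Bundles using (_⇔_; Func; Equivalence; mk⇔)
open import Relation.Binary.Definitions using (_Respects_)
open import Relation.Binary.PropositionalEquality.Core as ≡ using (_≡_)
open import Relation.Nullary using (¬_; Dec; yes; no)
open import Relation.Nullary.Decidable using (map′)
open import Relation.Nullary.Negation using (contradiction)
open import Relation.Unary using (Pred; _∈_; _⊆_; _⟨×⟩_)

-- Ideals, units modulo an ideal and Jacobson radicals in a commutative ring.

module RingFacts {ℓ : Level} (R : CommutativeRing ℓ ℓ) where
  open CommutativeRing R hiding (zero)
  open import Algebra.Properties.Ring ring using (-‿distribˡ-*; -1*x≈-x)
  open import Algebra.Properties.Group +-group using (inverseˡ-unique; //-rightDividesˡ; //-rightDividesʳ)
  open import Algebra.Properties.CommutativeSemigroup +-commutativeSemigroup using (xy∙z≈xz∙y)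
  open import Algebra.Properties.Semiring.Sum semiring using (sum; sum-cong-≋; *-distribˡ-sum)
  open import Algebra.Solver.Ring.NaturalCoefficients.Default commutativeSemiring using (solve; con; _:+_; _:*_; _:=_)
  open import Relation.Binary.Reasoning.Setoid setoid

  x+y≈z⇒x-z≈-y : ∀ {x y z} → x + y ≈ z → x - z ≈ - y
  x+y≈z⇒x-z≈-y {x} {y} {z} x+y≈z = inverseˡ-unique _ _ $ begin
    x - z + y    ≈⟨ xy∙z≈xz∙y x (- z) y ⟩
    x + y - z    ≈⟨ +-congʳ x+y≈z ⟩
    z - z        ≈⟨ -‿inverseʳ z ⟩
    0#           ∎

  x-y≈z⇒x≈y+z : ∀ {x y z} → x - y ≈ z → x ≈ y + z
  x-y≈z⇒x≈y+z {x} {y} {z} x-y≈z = begin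
    x            ≈⟨ //-rightDividesˡ y x ⟨
    x - y + y    ≈⟨ +-comm _ _ ⟩
    y + (x - y)  ≈⟨ +-congˡ x-y≈z ⟩
    y + z        ∎

  x≈y+z⇒x-y≈z : ∀ {x y z} → x ≈ y + z → x - y ≈ z
  x≈y+z⇒x-y≈z {x} {y} {z} x≈y+z = begin
    x - y        ≈⟨ +-congʳ (trans x≈y+z (+-comm y z)) ⟩
    z + y - y    ≈⟨ //-rightDividesʳ y z ⟩
    z            ∎

  module _ {I : Pred Carrier ℓ} (I-isIdeal : IsIdeal R I) where
    open IsIdeal I-isIdeal renaming (0∈ to 0∈I)

    -‿∈ : ∀ {x} → x ∈ I → - x ∈ I
    -‿∈ {x} x∈I = resp (-1*x≈-x x) (*-closed (- 1#) x∈I)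

    x-y∈⇒y∈ : ∀ {x y} → x ∈ I → x - y ∈ I → y ∈ I
    x-y∈⇒y∈ {x} {y} x∈I x-y∈I = resp x-[x-y]≈y (+-closed x∈I (-‿∈ x-y∈I))
      where
      x-[x-y]≈y : x - (x - y) ≈ y
      x-[x-y]≈y = x≈y+z⇒x-y≈z (sym (//-rightDividesˡ y x))

    ⟨⟩⊆ : ∀ {n} (f : Vector Carrier n) → (∀ i → f i ∈ I) → ⟨_⟩ R f ⊆ I
    ⟨⟩⊆ f f∈I (a , g≈) = resp (sym g≈) (sum∈ a f f∈I)
      where
      sum∈ : ∀ {n} (a f : Vector Carrier n) → (∀ i → f i ∈ I) → sum (λ i → a i * f i) ∈ I
      sum∈ {zero}  a f f∈I = 0∈I
      sum∈ {suc n} a f f∈I =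
        +-closed (*-closed (a zero) (f∈I zero)) (sum∈ (a ∘ suc) (f ∘ suc) (f∈I ∘ suc))

  scale-combination : ∀ {n} x (a f : Vector Carrier n) →
                      x * sum (λ i → a i * f i) ≈ sum (λ i → x * a i * f i)
  scale-combination {n} x a f = trans (*-distribˡ-sum {n} x (λ i → a i * f i))
    (sum-cong-≋ {n} (λ i → sym (*-assoc x (a i) (f i))))

  ∷-∈⟨⟩ : ∀ {n} (f : Vector Carrier (suc n)) a b {g} → g ∈ ⟨_⟩ R (f ∘ suc) →
          a * f zero + b * g ∈ ⟨_⟩ R f
  ∷-∈⟨⟩ f a b (c , g≈) = (a ∷ λ i → b * c i) , +-congˡ (begin
    b * _                                ≈⟨ *-congˡ g≈ ⟩
    b * sum (λ i → c i * f (suc i))      ≈⟨ scale-combination b c (f ∘ suc) ⟩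
    sum (λ i → b * c i * f (suc i))      ∎)

  -- Write `w` as a₀u + s with s in `⟨ f ⟩`. Multiplying by the inverse `v` of `w` gives u(a₀v) = 1
  -- - vs, so a₀v inverts `u` modulo `⟨ f ⟩`.
  unit∈⟨∷⟩⇒unitModulo : ∀ {n} (f : Vector Carrier n) u {w} → w ∈ ⟨_⟩ R (u ∷ f) → IsUnit R w →
                        IsUnitModulo R (⟨_⟩ R f) u
  unit∈⟨∷⟩⇒unitModulo f u {w} (a , w≈) (v , wv≈1) =
    a zero * v , (λ i → - v * a (suc i)) , (begin
      u * (a zero * v) - 1#                 ≈⟨ x+y≈z⇒x-z≈-y u[av]+vs≈1 ⟩
      - (v * s)                             ≈⟨ -‿distribˡ-* v s ⟩
      - v * s                               ≈⟨ scale-combination (- v) (a ∘ suc) f ⟩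
      sum (λ i → - v * a (suc i) * f i)     ∎)
    where
    s = sum (λ i → a (suc i) * f i)
    u[av]+vs≈1 : u * (a zero * v) + v * s ≈ 1#
    u[av]+vs≈1 = begin
      u * (a zero * v) + v * s  ≈⟨ solve 4 (λ u a v s → u :* (a :* v) :+ v :* s := (a :* u :+ s) :* v) refl u (a zero) v s ⟩
      (a zero * u + s) * v      ≈⟨ *-congʳ (sym w≈) ⟩
      w * v                     ≈⟨ wv≈1 ⟩
      1#                        ∎

  unitModulo⇒1∈ : ∀ {I J : Pred Carrier ℓ} {u} → IsIdeal R J → I ⊆ J → u ∈ J →
                  IsUnitModulo R I u → 1# ∈ J
  unitModulo⇒1∈ {u = u} J-isIdeal I⊆J u∈J (v , uv-1∈I) = x-y∈⇒y∈ J-isIdeal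
    (IsIdeal.resp J-isIdeal (*-comm v u) (IsIdeal.*-closed J-isIdeal v u∈J)) (I⊆J uv-1∈I)

  UnitsModulo : ∀ {n} → Vector Carrier n → Carrier → Set ℓ
  UnitsModulo f g = ∀ h → IsUnitModulo R (⟨_⟩ R f) (1# + h * g)

  module _ (lem : ExcludedMiddle ℓ) where

    -- If `g` is outside `M`, maximality puts 1 into `M+Rg`, say 1 = m + ag. Then 1 - ag = m lies in
    -- `M`; being a unit modulo `⟨ f ⟩`, which `M` contains, it brings 1 into `M`.
    unitsModulo⇒∈Jac : ∀ {n} (f : Vector Carrier n) g → UnitsModulo f g → g ∈ Jac R (⟨_⟩ R f)
    unitsModulo⇒∈Jac f g units M M-isMaximal ⟨f⟩⊆M with lem {P = M g}
    ... | yes g∈M = g∈M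
    ... | no  g∉M = contradiction 1∈M proper
      where
      open IsMaximalIdeal M-isMaximal
      module M = IsIdeal isIdeal

      M+Rg : Pred Carrier ℓ
      M+Rg x = ∃₂ λ m a → m ∈ M × x ≈ m + a * g

      M+Rg-isIdeal : IsIdeal R M+Rg
      M+Rg-isIdeal = record
        { resp     = λ x≈y (m , a , m∈M , x≈) → m , a , m∈M , trans (sym x≈y) x≈
        ; 0∈       = 0# , 0# , M.0∈ , solve 1 (λ g → con 0 := con 0 :+ con 0 :* g) refl g
        ; +-closed = λ (m , a , m∈M , x≈) (m′ , a′ , m′∈M , x′≈) →
            m + m′ , a + a′ , M.+-closed m∈M m′∈M , trans (+-cong x≈ x′≈)
              (solve 5 (λ m a m′ a′ g → (m :+ a :* g) :+ (m′ :+ a′ :* g) := (m :+ m′) :+ (a :+ a′) :* g)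
                refl m a m′ a′ g)
        ; *-closed = λ r (m , a , m∈M , x≈) → r * m , r * a , M.*-closed r m∈M , trans (*-congˡ x≈)
              (solve 4 (λ r m a g → r :* (m :+ a :* g) := r :* m :+ r :* a :* g) refl r m a g)
        }

      M⊆M+Rg : M ⊆ M+Rg
      M⊆M+Rg {m} m∈M = m , 0# , m∈M , solve 2 (λ m g → m := m :+ con 0 :* g) refl m g

      g∈M+Rg : g ∈ M+Rg
      g∈M+Rg = 0# , 1# , M.0∈ , solve 1 (λ g → g := con 0 :+ con 1 :* g) refl g

      1∈M : 1# ∈ M
      1∈M with lem {P = M+Rg 1#}
      ... | no  1∉ = contradiction (maximal M+Rg M+Rg-isIdeal M⊆M+Rg 1∉ g∈M+Rg) g∉M
      ... | yes (m , a , m∈M , 1≈m+ag) =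
        unitModulo⇒1∈ isIdeal ⟨f⟩⊆M (M.resp m≈1-ag m∈M) (units (- a))
        where
        m≈1-ag : m ≈ 1# + - a * g
        m≈1-ag = sym (trans (+-congˡ (sym (-‿distribˡ-* a g)))
          (x≈y+z⇒x-y≈z (trans 1≈m+ag (+-comm _ _))))

  -- Semantics of quantifier blocks and of `jacFormula`.

  -- Unlike _++_, this computes to _∷_ on suc k, as the semantics of quantifiers requires.
  extend : ∀ k {n} → Vector Carrier k → Vector Carrier n → Vector Carrier (k ℕ.+ n)
  extend zero    a ρ = ρ
  extend (suc k) a ρ = a zero ∷ extend k (a ∘ suc) ρ

  extend-↑ˡ : ∀ {k n} (a : Vector Carrier k) (ρ : Vector Carrier n) i → extend k a ρ (i ↑ˡ n) ≡ a i
  extend-↑ˡ a ρ zero    = ≡.refl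
  extend-↑ˡ a ρ (suc i) = extend-↑ˡ (a ∘ suc) ρ i

  extend-↑ʳ : ∀ k {n} (a : Vector Carrier k) (ρ : Vector Carrier n) j → extend k a ρ (k ↑ʳ j) ≡ ρ j
  extend-↑ʳ zero    a ρ j = ≡.refl
  extend-↑ʳ (suc k) a ρ j = extend-↑ʳ k (a ∘ suc) ρ j

  module _ {S : Set} (⟦_⟧ᵖ : S → Pred Carrier ℓ) where
    open Semantics R ⟦_⟧ᵖ

    -- Since `ex^` pushes each further quantifier inside, the recursive call assigns the outer `k`
    -- variables first; the innermost witness `b` belongs to variable zero and becomes the head of
    -- the vector.
    Sat-ex^⇔ : ∀ k {n} (φ : Formula S (k ℕ.+ n)) (ρ : Vector Carrier n) →
               Sat (ex^ k φ) ρ ⇔ (Σ[ a ∈ Vector Carrier k ] Sat φ (extend k a ρ))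
    Sat-ex^⇔ zero    φ ρ = mk⇔ (λ s → [] , s) proj₂
    Sat-ex^⇔ (suc k) φ ρ = mk⇔
      (λ s → let a , b , t = Equivalence.to (Sat-ex^⇔ k (ex φ) ρ) s in (b ∷ a) , t)
      (λ (a , t) → Equivalence.from (Sat-ex^⇔ k (ex φ) ρ) (a ∘ suc , a zero , t))

    -- `foldl` associates to the left and `sum` to the right, so the induction runs over an
    -- arbitrary starting term `s`, which absorbs one summand at a time.
    ⟦foldl-⊕⟧ : ∀ {k n} (s : Term k) (t : Vector (Term k) n) ρ →
                ⟦ foldl _⊕_ s t ⟧ ρ ≈ ⟦ s ⟧ ρ + sum (λ j → ⟦ t j ⟧ ρ)
    ⟦foldl-⊕⟧ {n = zero}  s t ρ = sym (+-identityʳ _)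
    ⟦foldl-⊕⟧ {n = suc n} s t ρ = trans (⟦foldl-⊕⟧ (s ⊕ t zero) (t ∘ suc) ρ) (+-assoc _ _ _)

  module _ (⟦_⟧ᵖ : ⊥ → Pred Carrier ℓ) where
    open Semantics R ⟦_⟧ᵖ

    -- Once the variables are looked up, the matrix reads (1 + hg)z = 1 + Σ yⱼfⱼ. Moving the 1 to
    -- the left says that `z` inverts 1 + hg modulo `⟨ f ⟩`, with the yⱼ as coefficients.
    jacFormula⇔unitsModulo : ∀ n (f : Vector Carrier n) g →
                             Sat (jacFormula n) (g ∷ f) ⇔ UnitsModulo f g
    jacFormula⇔unitsModulo n f g = mk⇔
      (λ sat h → let y , z , eq = Equivalence.to (Sat-ex^⇔ ⟦_⟧ᵖ n (ex matrix) (h ∷ g ∷ f)) (sat h) in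
        z , y , x≈y+z⇒x-y≈z (trans (sym (lhs h y z)) (trans eq (rhs h y z))))
      (λ units h → let z , y , eq = units h in Equivalence.from (Sat-ex^⇔ ⟦_⟧ᵖ n (ex matrix) (h ∷ g ∷ f))
        (y , z , trans (lhs h y z) (trans (x-y≈z⇒x≈y+z eq) (sym (rhs h y z)))))
      where
      -- `product` and `matrix` repeat the body of `jacFormula n` with its local abbreviations
      -- unfolded.
      product : Fin n → Term (suc (n ℕ.+ suc (suc n)))
      product j = var (suc (j ↑ˡ suc (suc n))) · var (suc (n ↑ʳ suc (suc j)))

      matrix : RingFormula (suc (n ℕ.+ suc (suc n)))
      matrix = (𝟏 ⊕ var (suc (n ↑ʳ zero)) · var (suc (n ↑ʳ suc zero))) · var zero ≐̇ foldl _⊕_ 𝟏 product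

      module _ (h : Carrier) (y : Vector Carrier n) (z : Carrier) where
        ρ = h ∷ g ∷ f
        at = λ j → reflexive (extend-↑ʳ n y ρ j)

        lhs : (1# + extend n y ρ (n ↑ʳ zero) * extend n y ρ (n ↑ʳ suc zero)) * z ≈ (1# + h * g) * z
        lhs = *-congʳ (+-congˡ (*-cong (at zero) (at (suc zero))))

        rhs : ⟦ foldl _⊕_ 𝟏 product ⟧ (z ∷ extend n y ρ) ≈ 1# + sum (λ j → y j * f j)
        rhs = trans (⟦foldl-⊕⟧ ⟦_⟧ᵖ 𝟏 product (z ∷ extend n y ρ))
          (+-congˡ (sum-cong-≋ (λ j → *-cong (reflexive (extend-↑ˡ y ρ j)) (at (suc (suc j))))))

-- Polynomials without roots over a field and their homogenisations.

module FieldFacts {ℓ : Level} (K : CommutativeRing ℓ ℓ) (K-isField : IsField K)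
  (lem : ExcludedMiddle ℓ) where
  open CommutativeRing K hiding (zero)
  open IsField K-isField
  open import Algebra.Properties.Semiring.Exp semiring using (_^_)
  open import Algebra.Properties.Semiring.Sum semiring using (sum; sum-cong-≋; *-distribˡ-sum)
  open import Algebra.Solver.Ring.NaturalCoefficients.Default commutativeSemiring using (solve; con; _:+_; _:*_; _:=_)
  open import Relation.Binary.Reasoning.Setoid setoid

  xy≈0⇒y≈0 : ∀ {x y} → ¬ x ≈ 0# → x * y ≈ 0# → y ≈ 0#
  xy≈0⇒y≈0 {x} {y} x≉0 xy≈0 = let z , xz≈1 = inverse x x≉0 in begin
    y            ≈⟨ *-identityˡ y ⟨
    1# * y       ≈⟨ *-congʳ xz≈1 ⟨
    x * z * y    ≈⟨ solve 3 (λ x y z → x :* z :* y := z :* (x :* y)) refl x y z ⟩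
    z * (x * y)  ≈⟨ *-congˡ xy≈0 ⟩
    z * 0#       ≈⟨ zeroʳ z ⟩
    0#           ∎

  xy≉0 : ∀ {x y} → ¬ x ≈ 0# → ¬ y ≈ 0# → ¬ x * y ≈ 0#
  xy≉0 x≉0 y≉0 xy≈0 = y≉0 (xy≈0⇒y≈0 x≉0 xy≈0)

  x*x≈0⇒x≈0 : ∀ {x} → x * x ≈ 0# → x ≈ 0#
  x*x≈0⇒x≈0 {x} xx≈0 with lem {P = x ≈ 0#}
  ... | yes x≈0 = x≈0
  ... | no  x≉0 = xy≈0⇒y≈0 x≉0 xx≈0

  x^n≈0⇒x≈0 : ∀ n {x} → x ^ n ≈ 0# → x ≈ 0#
  x^n≈0⇒x≈0 zero    1≈0 = contradiction (sym 1≈0) 0≉1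
  x^n≈0⇒x≈0 (suc n) {x} eq with lem {P = x ≈ 0#}
  ... | yes x≈0 = x≈0
  ... | no  x≉0 = x^n≈0⇒x≈0 n (xy≈0⇒y≈0 x≉0 eq)

  -- Σ pᵢ xⁱ yⁿ⁻ⁱ
  homogenise : ∀ n → Vector Carrier (suc n) → Carrier → Carrier → Carrier
  homogenise zero    p x y = p zero
  homogenise (suc n) p x y = homogenise n (p ∘ suc) x y * x + p zero * y ^ n * y

  eval-suc : ∀ n (p : Vector Carrier (suc n)) x →
             eval K p x ≈ p zero + x * eval K (p ∘ suc) x
  eval-suc n p x = +-cong (*-identityʳ (p zero)) (trans
    (sum-cong-≋ {n} (λ i → solve 3 (λ p x y → p :* (x :* y) := x :* (p :* y)) refl (p (suc i)) x (x ^ toℕ i)))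
    (sym (*-distribˡ-sum {n} x (λ i → p (suc i) * x ^ toℕ i))))

  yz≈1⇒y^n*z^n≈1 : ∀ n {y z} → y * z ≈ 1# → y ^ n * z ^ n ≈ 1#
  yz≈1⇒y^n*z^n≈1 zero    yz≈1 = *-identityˡ 1#
  yz≈1⇒y^n*z^n≈1 (suc n) {y} {z} yz≈1 = begin
    y * y ^ n * (z * z ^ n)     ≈⟨ solve 4 (λ y a z b → y :* a :* (z :* b) := y :* z :* (a :* b)) refl y (y ^ n) z (z ^ n) ⟩
    y * z * (y ^ n * z ^ n)     ≈⟨ *-cong yz≈1 (yz≈1⇒y^n*z^n≈1 n yz≈1) ⟩
    1# * 1#                     ≈⟨ *-identityˡ 1# ⟩
    1#                          ∎

  homogenise-y≈0 : ∀ n p x {y} → y ≈ 0# → homogenise n p x y ≈ p (fromℕ n) * x ^ n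
  homogenise-y≈0 zero    p x y≈0 = sym (*-identityʳ _)
  homogenise-y≈0 (suc n) p x {y} y≈0 = begin
    homogenise n (p ∘ suc) x y * x + p zero * y ^ n * y  ≈⟨ +-cong (*-congʳ (homogenise-y≈0 n (p ∘ suc) x y≈0)) (*-congˡ y≈0) ⟩
    p (suc (fromℕ n)) * x ^ n * x + p zero * y ^ n * 0#
      ≈⟨ solve 4 (λ p a x q → p :* a :* x :+ q :* con 0 := p :* (x :* a)) refl (p (suc (fromℕ n))) (x ^ n) x (p zero * y ^ n) ⟩
    p (suc (fromℕ n)) * (x * x ^ n)                       ∎

  -- Dehomogenisation: dividing the form by yⁿ, with `z` = 1/y, leaves `p` evaluated at x/y. The
  -- recursion matches Horner's scheme in `eval-suc`.
  homogenise-y-unit : ∀ n p x {y z} → y * z ≈ 1# → z ^ n * homogenise n p x y ≈ eval K p (x * z)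
  homogenise-y-unit zero    p x yz≈1 = solve 1 (λ p → con 1 :* p := p :* con 1 :+ con 0) refl (p zero)
  homogenise-y-unit (suc n) p x {y} {z} yz≈1 = begin
    z * z ^ n * (H * x + p zero * y ^ n * y)
      ≈⟨ solve 7 (λ z b h x p a y → z :* b :* (h :* x :+ p :* a :* y) := p :* (y :* z :* (a :* b)) :+ x :* z :* (b :* h)) refl z (z ^ n) H x (p zero) (y ^ n) y ⟩
    p zero * (y * z * (y ^ n * z ^ n)) + x * z * (z ^ n * H)
      ≈⟨ +-cong (*-congˡ (*-cong yz≈1 (yz≈1⇒y^n*z^n≈1 n yz≈1))) (*-congˡ (homogenise-y-unit n (p ∘ suc) x yz≈1)) ⟩
    p zero * (1# * 1#) + x * z * eval K (p ∘ suc) (x * z)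
      ≈⟨ +-congʳ (trans (*-congˡ (*-identityˡ 1#)) (*-identityʳ _)) ⟩
    p zero + x * z * eval K (p ∘ suc) (x * z)
      ≈⟨ eval-suc (suc n) p (x * z) ⟨
    eval K p (x * z) ∎
    where
    H = homogenise n (p ∘ suc) x y

  -- On the line y = 0 the form is pₙxⁿ with pₙ ≠ 0, which forces x = 0. Off that line, a zero of
  -- the form would make x/y a root of `p`.
  homogenise≈0 : ∀ n p → HasDegree K n p → ¬ (∃[ x ] eval K p x ≈ 0#) →
                 ∀ {x y} → homogenise n p x y ≈ 0# → x ≈ 0# × y ≈ 0#
  homogenise≈0 n p pₙ≉0 rootless {x} {y} H≈0 with lem {P = y ≈ 0#}
  ... | yes y≈0 = x^n≈0⇒x≈0 n (xy≈0⇒y≈0 pₙ≉0 (trans (sym (homogenise-y≈0 n p x y≈0)) H≈0)) , y≈0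
  ... | no  y≉0 = let z , yz≈1 = inverse y y≉0 in contradiction
    (x * z , trans (sym (homogenise-y-unit n p x yz≈1)) (trans (*-congˡ H≈0) (zeroʳ _))) rootless

  -- Zero-detecting combinations and the units they produce.

  -- For a ring A of functions to K, α(f,g)·f + β(f,g)·g lies in the ideal (f,g)
  -- and its zeros are the common zeros of f and g.
  record ZeroDetecting {X : Set ℓ} (A : FunctionRing K X) : Set ℓ where
    open Subring A using (contains)
    field
      α β      : Carrier → Carrier → Carrier
      α-closed : ∀ f g → f ∈ contains → g ∈ contains → (λ x → α (f x) (g x)) ∈ contains
      β-closed : ∀ f g → f ∈ contains → g ∈ contains → (λ x → β (f x) (g x)) ∈ contains
      detects  : ∀ x y → α x y * x + β x y * y ≈ 0# → x ≈ 0# × y ≈ 0#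

  module _ {X : Set ℓ} (A : FunctionRing K X) (constants : ContainsConstants K X A) where
    open Subring A using (contains) renaming (1∈ to 1∈A; +-closed to +-closedᴬ; *-closed to *-closedᴬ)

    ^-closed : ∀ n {g} → g ∈ contains → (λ x → g x ^ n) ∈ contains
    ^-closed zero    g∈A = 1∈A
    ^-closed (suc n) g∈A = *-closedᴬ g∈A (^-closed n g∈A)

    homogenise-closed : ∀ n p {f g} → f ∈ contains → g ∈ contains →
                        (λ x → homogenise n p (f x) (g x)) ∈ contains
    homogenise-closed zero    p f∈A g∈A = constants (p zero)
    homogenise-closed (suc n) p f∈A g∈A = +-closedᴬ
      (*-closedᴬ (homogenise-closed n (p ∘ suc) f∈A g∈A) f∈A)
      (*-closedᴬ (*-closedᴬ (constants (p zero)) (^-closed n g∈A)) g∈A)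

    -- The defining clause of `homogenise (suc n)` already has the shape αx + βy. Positive degree is
    -- demanded because `AlgebraicallyClosed` promises roots only there; if all such polynomials had
    -- roots, `K` would be algebraically closed.
    conditionA⇒zeroDetecting : ConditionA K X A → ZeroDetecting A
    conditionA⇒zeroDetecting notClosed
      with lem {P = ∃₂ λ n p → HasDegree K (suc n) p × ¬ (∃[ x ] eval K p x ≈ 0#)}
    ... | yes (n , p , degree , rootless) = record
      { α        = homogenise n (p ∘ suc)
      ; β        = λ x y → p zero * y ^ n
      ; α-closed = λ f g f∈A g∈A → homogenise-closed n (p ∘ suc) f∈A g∈A
      ; β-closed = λ f g f∈A g∈A → *-closedᴬ (constants (p zero)) (^-closed n g∈A)
      ; detects  = λ x y → homogenise≈0 (suc n) p degree rootless
      }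
    ... | no  ¬rootless = ⊥-elim (notClosed closed)
      where
      closed : AlgebraicallyClosed K
      closed n p degree with lem {P = ∃[ x ] eval K p x ≈ 0#}
      ... | yes root = root
      ... | no  rootless = contradiction (n , p , degree , rootless) ¬rootless

    module _ (units : ZeroFreeAreUnits K X A) (zeroDetecting : ZeroDetecting A) where
      open ZeroDetecting zeroDetecting
      private
        Aᶜ = CommutativeRing.Carrier (Subring.commutativeRing A)
        module Aᴿ = CommutativeRing (Subring.commutativeRing A)
        module F = RingFacts (Subring.commutativeRing A)

      -- Induction on the number of generators: the function `g` found for the tail is merged with
      -- the head `f₀` into αf₀ + βg. The empty family takes the zero function, which is the empty
      -- sum.
      ∈⟨⟩-with-common-zeros : ∀ {n} (f : Vector Aᶜ n) →
        ∃[ g ] (g ∈ ⟨_⟩ (Subring.commutativeRing A) f × ∀ {x} → x ∈ Zeros K X A g → ∀ i → x ∈ Zeros K X A (f i))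
      ∈⟨⟩-with-common-zeros {zero}  f = Aᴿ.0# , ((λ ()) , λ _ → refl) , λ _ ()
      ∈⟨⟩-with-common-zeros {suc n} f =
        let g , g∈ , zeros = ∈⟨⟩-with-common-zeros (f ∘ suc)
            f₀ = f zero
            a = _ , α-closed (proj₁ f₀) (proj₁ g) (proj₂ f₀) (proj₂ g)
            b = _ , β-closed (proj₁ f₀) (proj₁ g) (proj₂ f₀) (proj₂ g)
        in a Aᴿ.* f₀ Aᴿ.+ b Aᴿ.* g , F.∷-∈⟨⟩ f a b {g} g∈
          , λ h≈0 → λ { zero → proj₁ (detects _ _ h≈0) ; (suc i) → zeros (proj₂ (detects _ _ h≈0)) i }

      -- Where `u` = 1 + hg and all members of `f` vanish, `g` vanishes too, so `u` equals 1 there,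
      -- which is absurd. Hence the function `w` obtained for `u ∷ f` has no zero and is a unit, and
      -- `u` becomes a unit modulo `⟨ f ⟩`.
      zerosIncluded⇒unitsModulo : ∀ {n} (f : Vector Aᶜ n) g → ZerosIncluded K X A f g → F.UnitsModulo f g
      zerosIncluded⇒unitsModulo f g included h =
        let u = Aᴿ.1# Aᴿ.+ h Aᴿ.* g
            w , w∈ , zeros = ∈⟨⟩-with-common-zeros (u ∷ f)
        in F.unit∈⟨∷⟩⇒unitModulo f u {w} w∈ (units w λ x w≈0 → 0≉1 (begin
          0#                              ≈⟨ zeros w≈0 zero ⟨
          1# + proj₁ h x * proj₁ g x      ≈⟨ +-congˡ (*-congˡ (included (λ i → zeros w≈0 (suc i)))) ⟩
          1# + proj₁ h x * 0#             ≈⟨ solve 1 (λ h → con 1 :+ h :* con 0 := con 1) refl (proj₁ h x) ⟩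
          1#                              ∎))

    -- Maximal ideals of functions vanishing at a point.

    module _ (x : X) where
      private
        Aᴿ = Subring.commutativeRing A
        Aᶜ = CommutativeRing.Carrier Aᴿ

      Vanishing : Pred Aᶜ ℓ
      Vanishing f = x ∈ Zeros K X A f

      vanishing-isIdeal : IsIdeal Aᴿ Vanishing
      vanishing-isIdeal = record
        { resp     = λ f≈g f≈0 → trans (sym (f≈g x)) f≈0
        ; 0∈       = refl
        ; +-closed = λ f≈0 g≈0 → trans (+-cong f≈0 g≈0) (+-identityˡ 0#)
        ; *-closed = λ h f≈0 → trans (*-congˡ f≈0) (zeroʳ _)
        }

      -- Suppose an ideal `J` above `Vanishing` contains `j` with j(x) ≠ 0. The constant c = 1/j(x)
      -- belongs to the ring and cj - 1 vanishes at `x`; so cj and cj - 1 both lie in `J`, and with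
      -- them 1.
      vanishing-isMaximal : IsMaximalIdeal Aᴿ Vanishing
      vanishing-isMaximal = record
        { isIdeal = vanishing-isIdeal
        ; proper  = λ 1≈0 → 0≉1 (sym 1≈0)
        ; maximal = maximal
        }
        where
        maximal : ∀ J → IsIdeal Aᴿ J → Vanishing ⊆ J → ¬ CommutativeRing.1# Aᴿ ∈ J → J ⊆ Vanishing
        maximal J J-isIdeal V⊆J 1∉J {j} j∈J with lem {P = proj₁ j x ≈ 0#}
        ... | yes jx≈0 = jx≈0
        ... | no  jx≉0 = let c , jx*c≈1 = inverse (proj₁ j x) jx≉0
                             cᴬ = const c , constants c
          in contradiction
            (RingFacts.x-y∈⇒y∈ Aᴿ J-isIdeal {CommutativeRing._*_ Aᴿ cᴬ j} {CommutativeRing.1# Aᴿ} (IsIdeal.*-closed J-isIdeal cᴬ j∈J)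
              (V⊆J (RingFacts.x≈y+z⇒x-y≈z K (trans (trans (*-comm _ _) jx*c≈1) (sym (+-identityʳ 1#))))))
            1∉J

      ∈Jac⇒vanishing : ∀ {n} (f : Vector Aᶜ n) g → (∀ i → Vanishing (f i)) →
                       g ∈ Jac Aᴿ (⟨_⟩ Aᴿ f) → Vanishing g
      ∈Jac⇒vanishing f g f≈0 g∈Jac =
        g∈Jac Vanishing vanishing-isMaximal (λ {h} → RingFacts.⟨⟩⊆ Aᴿ vanishing-isIdeal f f≈0 {h})

-- Sums of squares in a real closed field.

module _ {ℓ : Level} (R : CommutativeRing ℓ ℓ) (R-isRealClosed : IsRealClosed R) (lem : ExcludedMiddle ℓ) where
  open CommutativeRing R hiding (zero)
  open IsRealClosed R-isRealClosed
  open IsField isField using (inverse)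
  open import Algebra.Properties.Group +-group using (inverseʳ-unique)
  open import Algebra.Properties.Semiring.Sum semiring using (sum; sum-cong-≋; *-distribˡ-sum)
  open import Algebra.Solver.Ring.NaturalCoefficients.Default commutativeSemiring using (solve; con; _:+_; _:*_; _:=_)
  open import Relation.Binary.Reasoning.Setoid setoid

  -- If `a` were non-zero, dividing the equation by a² would exhibit -1 as a sum of squares,
  -- contrary to formal reality.
  square+squares≈0⇒≈0 : ∀ {n} a (v : Vector Carrier n) → a * a + sum (λ i → v i * v i) ≈ 0# → a ≈ 0#
  square+squares≈0⇒≈0 {n} a v eq with lem {P = a ≈ 0#}
  ... | yes a≈0 = a≈0
  ... | no  a≉0 = let e , ae≈1 = inverse a a≉0 in contradiction
    (inverseʳ-unique _ _ (begin
      1# + sum (λ i → e * v i * (e * v i))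
        ≈⟨ +-cong (trans (sym (*-identityˡ 1#)) (*-cong (sym ae≈1) (sym ae≈1)))
             (sum-cong-≋ {n} (λ i → solve 2 (λ e v → e :* v :* (e :* v) := e :* e :* (v :* v)) refl e (v i))) ⟩
      a * e * (a * e) + sum (λ i → e * e * (v i * v i))
        ≈⟨ +-congˡ (*-distribˡ-sum {n} (e * e) (λ i → v i * v i)) ⟨
      a * e * (a * e) + e * e * sum (λ i → v i * v i)
        ≈⟨ solve 3 (λ a e s → a :* e :* (a :* e) :+ e :* e :* s := e :* e :* (a :* a :+ s)) refl a e (sum (λ i → v i * v i)) ⟩
      e * e * (a * a + sum (λ i → v i * v i))
        ≈⟨ *-congˡ eq ⟩
      e * e * 0#
        ≈⟨ zeroʳ _ ⟩
      0# ∎))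
    (formallyReal (λ i → e * v i))

  four-squares≈0 : ∀ a b c d → a * a + b * b + (c * c + d * d) ≈ 0# → (a ≈ 0# × b ≈ 0#) × c ≈ 0# × d ≈ 0#
  four-squares≈0 a b c d eq =
      ( square+squares≈0⇒≈0 a (b ∷ c ∷ d ∷ []) (trans (solve 4 (λ a b c d → a :+ (b :+ (c :+ (d :+ con 0))) := a :+ b :+ (c :+ d)) refl _ _ _ _) eq)
      , square+squares≈0⇒≈0 b (a ∷ c ∷ d ∷ []) (trans (solve 4 (λ a b c d → b :+ (a :+ (c :+ (d :+ con 0))) := a :+ b :+ (c :+ d)) refl _ _ _ _) eq))
    , square+squares≈0⇒≈0 c (a ∷ b ∷ d ∷ []) (trans (solve 4 (λ a b c d → c :+ (a :+ (b :+ (d :+ con 0))) := a :+ b :+ (c :+ d)) refl _ _ _ _) eq)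
    , square+squares≈0⇒≈0 d (a ∷ b ∷ c ∷ []) (trans (solve 4 (λ a b c d → d :+ (a :+ (b :+ (c :+ con 0))) := a :+ b :+ (c :+ d)) refl _ _ _ _) eq)

-- Case (b): conjugation and norms.

module _ {ℓ : Level} (K : CommutativeRing ℓ ℓ) (K-isField : IsField K) (lem : ExcludedMiddle ℓ) where
  open CommutativeRing K hiding (zero)
  open FieldFacts K K-isField lem using (ZeroDetecting)

  -- With x = a + bi and y = c + di, the sum of the two norms is the image under `ι` of a² + b² + c²
  -- + d². If it is zero, injectivity of `ι` makes the sum of squares vanish in `R`, and each
  -- coordinate with it.
  conditionB⇒zeroDetecting : ∀ {X : Set ℓ} (A : FunctionRing K X) → ConditionB K X A → ZeroDetecting A
  conditionB⇒zeroDetecting A B = record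
    { α        = λ x y → conj x
    ; β        = λ x y → conj y
    ; α-closed = λ f g f∈A g∈A → conj-closed f f∈A
    ; β-closed = λ f g f∈A g∈A → conj-closed g g∈A
    ; detects  = λ x y eq →
        let a , b , x≈ = K≈R[i] x
            c , d , y≈ = K≈R[i] y
            (a≈0 , b≈0) , (c≈0 , d≈0) = four-squares≈0 R isRealClosed lem a b c d
              (ι-≈0 (trans (ι-norms a b c d) (trans (sym (+-cong (conj-norm x) (conj-norm y))) eq)))
        in trans x≈ (coordinates≈0 a≈0 b≈0) , trans y≈ (coordinates≈0 c≈0 d≈0)
    }
    where
    open ConditionB B
    open RealClosedSubfieldWithClosure realClosed
    open IsAlgebraicClosure isAlgebraicClosure using (isRingHomomorphism)
    open import Algebra.Morphism.Structures using (IsRingHomomorphism)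
    open IsRingHomomorphism isRingHomomorphism using (⟦⟧-cong; +-homo; *-homo; 0#-homo; 1#-homo)
    module R = CommutativeRing R
    open import Algebra.Properties.Ring ring using (-‿distribˡ-*; -‿distribʳ-*)
    open import Algebra.Properties.Group +-group using (⁻¹-involutive)
    open import Algebra.Solver.Ring.NaturalCoefficients.Default commutativeSemiring using (solve; con; _:+_; _:*_; _:=_)
    open import Relation.Binary.Reasoning.Setoid setoid

    ι-≈0 : ∀ {r} → ι r ≈ 0# → r R.≈ R.0#
    ι-≈0 {r} ιr≈0 with lem {P = r R.≈ R.0#}
    ... | yes r≈0 = r≈0
    ... | no  r≉0 = let s , rs≈1 = IsField.inverse (IsRealClosed.isField isRealClosed) r r≉0 in
      contradiction (begin
        0#          ≈⟨ zeroˡ (ι s) ⟨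
        0# * ι s    ≈⟨ *-congʳ ιr≈0 ⟨
        ι r * ι s   ≈⟨ *-homo r s ⟨
        ι (r R.* s) ≈⟨ ⟦⟧-cong rs≈1 ⟩
        ι R.1#      ≈⟨ 1#-homo ⟩
        1#          ∎) (IsField.0≉1 K-isField)

    ι-norms : ∀ a b c d → ι (a R.* a R.+ b R.* b R.+ (c R.* c R.+ d R.* d)) ≈
              ι a * ι a + ι b * ι b + (ι c * ι c + ι d * ι d)
    ι-norms a b c d = trans (+-homo _ _) (+-cong (ι-norm a b) (ι-norm c d))
      where
      ι-norm : ∀ a b → ι (a R.* a R.+ b R.* b) ≈ ι a * ι a + ι b * ι b
      ι-norm a b = trans (+-homo _ _) (+-cong (*-homo a a) (*-homo b b))

    coordinates≈0 : ∀ {a b} → a R.≈ R.0# → b R.≈ R.0# → ι a + ι b * i ≈ 0#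
    coordinates≈0 a≈0 b≈0 = trans
      (+-cong (trans (⟦⟧-cong a≈0) 0#-homo) (trans (*-congʳ (trans (⟦⟧-cong b≈0) 0#-homo)) (zeroˡ i)))
      (+-identityˡ 0#)

    -[i²]≈1 : - (i * i) ≈ 1#
    -[i²]≈1 = trans (-‿cong i²≈-1) (⁻¹-involutive 1#)

    norm : ∀ p q → (p - q * i) * (p + q * i) ≈ p * p + q * q
    norm p q = begin
      (p - q * i) * (p + q * i)
        -- The product is expanded with `- (q * i)` held as an indeterminate `m`; its relations to
        -- `q` and `i` enter only in the next step.
        ≈⟨ solve 4 (λ p q i m → (p :+ m) :* (p :+ q :* i) := p :* p :+ m :* (q :* i) :+ p :* (m :+ q :* i)) refl p q i (- (q * i)) ⟩
      p * p + - (q * i) * (q * i) + p * (- (q * i) + q * i)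
        ≈⟨ +-cong (+-congˡ -qiqi≈qq) (*-congˡ (-‿inverseˡ (q * i))) ⟩
      p * p + q * q + p * 0#
        ≈⟨ trans (+-congˡ (zeroʳ p)) (+-identityʳ _) ⟩
      p * p + q * q ∎
      where
      -qiqi≈qq : - (q * i) * (q * i) ≈ q * q
      -qiqi≈qq = begin
        - (q * i) * (q * i)   ≈⟨ *-congʳ (-‿distribʳ-* q i) ⟩
        q * - i * (q * i)     ≈⟨ solve 3 (λ q i m → q :* m :* (q :* i) := q :* q :* (m :* i)) refl q i (- i) ⟩
        q * q * (- i * i)     ≈⟨ *-congˡ (trans (sym (-‿distribˡ-* i i)) -[i²]≈1) ⟩
        q * q * 1#            ≈⟨ *-identityʳ _ ⟩
        q * q                 ∎

    -- `conj z` is formed from the same coordinates that `K≈R[i] z` returns here, so only the second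
    -- factor is rewritten.
    conj-norm : ∀ z → let a , b , _ = K≈R[i] z in conj z * z ≈ ι a * ι a + ι b * ι b
    conj-norm z = let a , b , z≈ = K≈R[i] z in trans (*-congˡ z≈) (norm (ι a) (ι b))

  -- Case (c): a topology given by the non-zero ideals of `𝒪`.

  module _ {X : Set ℓ} (A : FunctionRing K X) (C : ConditionC K X A K-isField) where
    open ConditionC C
    open Topology topology
    open IsTopologicalField isTopologicalField
    open IsField K-isField
    open FieldFacts K K-isField lem using (xy≈0⇒y≈0; xy≉0; x*x≈0⇒x≈0)
    open import Algebra.Properties.Ring ring using (-‿distribˡ-*; x[y-z]≈xy-xz)
    open import Algebra.Properties.Group +-group using (inverseʳ-unique; ε⁻¹≈ε; x≈y⇒x∙y⁻¹≈ε; x∙y⁻¹≈ε⇒x≈y; //-rightDividesˡ)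
    open import Algebra.Solver.Ring.NaturalCoefficients.Default commutativeSemiring using (solve; con; _:+_; _:*_; _:=_)
    open import Relation.Binary.Reasoning.Setoid setoid
    private
      module 𝒪 = Subring 𝒪
      𝒪ᴿ = 𝒪.commutativeRing
      O = 𝒪.contains
      Oᶜ = ∃ O

    -- If 𝒪 were a field then 0 would be its only maximal ideal.
    nonzero-nonunit : ∃[ s ] (¬ proj₁ s ≈ 0# × ¬ IsUnit 𝒪ᴿ s)
    nonzero-nonunit with lem {P = ∃[ s ] (¬ proj₁ s ≈ 0# × ¬ IsUnit 𝒪ᴿ s)}
    ... | yes found = found
    ... | no  ¬found = let r , r∈Jac , r≉0 = Jac-nonZero in
      contradiction (r∈Jac IsZero isZero-isMaximal (λ x≈0 → x≈0)) r≉0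
      where
      IsZero : Pred Oᶜ ℓ
      IsZero s = proj₁ s ≈ 0#

      isZero-isMaximal : IsMaximalIdeal 𝒪ᴿ IsZero
      isZero-isMaximal = record
        { isIdeal = record
          { resp     = λ x≈y x≈0 → trans (sym x≈y) x≈0
          ; 0∈       = refl
          ; +-closed = λ x≈0 y≈0 → trans (+-cong x≈0 y≈0) (+-identityˡ 0#)
          ; *-closed = λ r x≈0 → trans (*-congˡ x≈0) (zeroʳ _)
          }
        ; proper  = λ 1≈0 → 0≉1 (sym 1≈0)
        ; maximal = maximal
        }
        where
        maximal : ∀ J → IsIdeal 𝒪ᴿ J → IsZero ⊆ J → ¬ CommutativeRing.1# 𝒪ᴿ ∈ J → J ⊆ IsZero
        maximal J J-isIdeal _ 1∉J {s} s∈J with lem {P = proj₁ s ≈ 0#}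
        ... | yes s≈0 = s≈0
        ... | no  s≉0 = contradiction (s , s≉0 , λ (v , sv≈1) →
          1∉J (IsIdeal.resp J-isIdeal (trans (*-comm _ _) sv≈1) (IsIdeal.*-closed J-isIdeal v s∈J))) ¬found

    -- Divisibility over `𝒪` and the neighbourhoods it defines.

    infix 4 _∣_
    -- This is y ∈ x𝒪 for arbitrary x and y in `K`. Thus 0 divides only 0, everything divides 0, and
    -- `x ∣ 1#` means that the inverse of x lies in `𝒪`.
    _∣_ : Carrier → Carrier → Set ℓ
    x ∣ y = ∃[ q ] (q ∈ O × q * x ≈ y)

    ∣-resp : ∀ {x x′ y y′} → x ≈ x′ → y ≈ y′ → x ∣ y → x′ ∣ y′
    ∣-resp x≈x′ y≈y′ (q , q∈ , qx≈y) = q , q∈ , trans (*-congˡ (sym x≈x′)) (trans qx≈y y≈y′)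

    ∣-trans : ∀ {x y z} → x ∣ y → y ∣ z → x ∣ z
    ∣-trans (q , q∈ , qx≈y) (r , r∈ , ry≈z) =
      r * q , 𝒪.*-closed r∈ q∈ , trans (*-assoc _ _ _) (trans (*-congˡ qx≈y) ry≈z)

    ∣-+ : ∀ {x y z} → x ∣ y → x ∣ z → x ∣ y + z
    ∣-+ {x} (q , q∈ , qx≈y) (r , r∈ , rx≈z) =
      q + r , 𝒪.+-closed q∈ r∈ , trans (distribʳ x q r) (+-cong qx≈y rx≈z)

    ∣-neg : ∀ {x y} → x ∣ y → x ∣ - y
    ∣-neg {x} (q , q∈ , qx≈y) = - q , 𝒪.-‿closed q∈ , trans (sym (-‿distribˡ-* q x)) (-‿cong qx≈y)

    x∣z-y⇒x∣y⇔x∣z : ∀ {x y z} → x ∣ z - y → (x ∣ y ⇔ x ∣ z)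
    x∣z-y⇒x∣y⇔x∣z {x} {y} {z} x∣z-y = mk⇔
      (λ x∣y → ∣-resp refl (//-rightDividesˡ y z) (∣-+ x∣z-y x∣y))
      (λ x∣z → ∣-resp refl (RingFacts.x≈y+z⇒x-y≈z K (sym (//-rightDividesˡ y z))) (∣-+ x∣z (∣-neg x∣z-y)))

    multiples-isNonZeroIdeal : ∀ {x} → ¬ x ≈ 0# → x ∈ O → IsNonZeroIdealOf K 𝒪 (x ∣_)
    multiples-isNonZeroIdeal {x} x≉0 x∈O = record
      { ideal   = λ y → x ∣ proj₁ y
      ; isIdeal = record
        { resp     = ∣-resp refl
        ; 0∈       = 0# , 𝒪.0∈ , zeroˡ x
        ; +-closed = ∣-+
        ; *-closed = λ (r , r∈) (q , q∈ , qx≈y) →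
            r * q , 𝒪.*-closed r∈ q∈ , trans (*-assoc r q x) (*-congˡ qx≈y)
        }
      ; isImage = (λ (q , q∈ , qx≈y) → 𝒪.resp qx≈y (𝒪.*-closed q∈ x∈O) , q , q∈ , qx≈y) , proj₂
      ; nonZero = x , (1# , 𝒪.1∈ , *-identityˡ x) , x≉0
      }

    -- Write x as a fraction a/b. Since xb = a, the fractional ideal x𝒪 contains the non-zero ideal
    -- a𝒪, which is a neighbourhood of 0.
    multiples-isNeighbourhood : ∀ {x} → ¬ x ≈ 0# → IsNeighbourhood 0# (x ∣_)
    multiples-isNeighbourhood {x} x≉0 =
      let a , b , a∈O , b∈O , b≉0 , xb≈a = isFractionField x
          a≉0 = λ a≈0 → xy≉0 x≉0 b≉0 (trans xb≈a a≈0)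
          V , V-open , 0∈V , V⊆ = ideal-isNeighbourhood (a ∣_) (multiples-isNonZeroIdeal a≉0 a∈O)
      in V , V-open , 0∈V , λ v∈V → ∣-trans (b , b∈O , trans (*-comm b x) xb≈a) (V⊆ v∈V)

    -- Continuity of addition at (z, c) gives a rectangle for each z with z + c in `V`; the
    -- translate is the union of the first sides of these rectangles.
    translate-open : ∀ c {V} → IsOpen V → IsOpen (λ z → z + c ∈ V)
    translate-open c {V} V-open = resp-≐
      ( (λ ((z , z+c∈V) , x∈) → let _ , _ , _ , _ , (_ , c∈) , ⊆V = +-continuous V V-open (z , c) z+c∈V in ⊆V (x∈ , c∈))
      , (λ {x} x+c∈V → let _ , _ , _ , _ , (x∈ , _) , _ = +-continuous V V-open (x , c) x+c∈V in (x , x+c∈V) , x∈))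
      (⋃-open (∃[ z ] z + c ∈ V) (λ (z , z+c∈V) → proj₁ (+-continuous V V-open (z , c) z+c∈V))
        (λ (z , z+c∈V) → proj₁ (proj₂ (proj₂ (+-continuous V V-open (z , c) z+c∈V)))))

    translate-neighbourhood : ∀ c {N} → IsNeighbourhood 0# N → IsNeighbourhood c (λ z → z - c ∈ N)
    translate-neighbourhood c (V , V-open , 0∈V , V⊆N) =
      _ , translate-open (- c) V-open , resp-≈ V-open (sym (-‿inverseʳ c)) 0∈V , V⊆N

    -- Units of `𝒪` close to 1.

    module _ {N : Pred Carrier ℓ} (N-isIdeal : IsNonZeroIdealOf K 𝒪 N) where
      open IsNonZeroIdealOf N-isIdeal

      nonZeroIdeal⊆O : N ⊆ O
      nonZeroIdeal⊆O x∈N = proj₁ (proj₁ isImage x∈N)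

      nonZeroIdeal-*-closed : ∀ {q x} → q ∈ O → x ∈ N → q * x ∈ N
      nonZeroIdeal-*-closed q∈O x∈N = proj₂ isImage (_ , IsIdeal.*-closed isIdeal (_ , q∈O) (proj₂ (proj₁ isImage x∈N)))

    s : Carrier
    s = proj₁ (proj₁ nonzero-nonunit)

    s∈O : s ∈ O
    s∈O = proj₂ (proj₁ nonzero-nonunit)

    s≉0 : ¬ s ≈ 0#
    s≉0 = proj₁ (proj₂ nonzero-nonunit)

    s∤1 : ¬ s ∣ 1#
    s∤1 (v , v∈O , vs≈1) = proj₂ (proj₂ nonzero-nonunit) ((v , v∈O) , trans (*-comm s v) vs≈1)

    -- An elementwise form of being a non-zero element of the Jacobson radical: 1 + j𝒪 consists of
    -- units of `𝒪`. Such a `j` is obtained from continuity of inversion; extracting it from maximal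
    -- ideals would call for Zorn's lemma.
    InfinitesimallyInvertible : Pred Carrier ℓ
    InfinitesimallyInvertible j =
      ¬ j ≈ 0# × ¬ j ∣ 1# × (∀ {q} → q ∈ O → q * j + 1# ∣ 1# × q * j + 1# ∈ O)

    -- The last hypothesis puts v - 1 into `𝒪`, in the form in which a translated neighbourhood
    -- delivers it; adding 1 gives v ∈ 𝒪.
    inverse-∣ : ∀ x (x≉0 : ¬ x ≈ 0#) → 1# ∣ proj₁ (inverse x x≉0) - 1# → x ∣ 1#
    inverse-∣ x x≉0 (p , p∈O , p1≈v-1) = v , v∈O , trans (*-comm v x) (proj₂ (inverse x x≉0))
      where
      v = proj₁ (inverse x x≉0)
      v∈O : v ∈ O
      v∈O = 𝒪.resp (trans (+-congʳ (trans (sym (*-identityʳ p)) p1≈v-1)) (//-rightDividesˡ 1# v)) (𝒪.+-closed p∈O 𝒪.1∈)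

    1≉0 : ¬ 1# ≈ 0#
    1≉0 1≈0 = 0≉1 (sym 1≈0)

    inverse-1 : proj₁ (inverse 1# 1≉0) ≈ 1#
    inverse-1 = trans (sym (*-identityˡ _)) (proj₂ (inverse 1# 1≉0))

    -- Inversion is continuous at 1 and 𝒪 is a neighbourhood of 1.
    inverses-near-1 : ∃[ N ] (IsNonZeroIdealOf K 𝒪 N × (∀ {x} → x ∈ N → ¬ x + 1# ≈ 0# → x + 1# ∣ 1#))
    inverses-near-1 = near-1 (translate-neighbourhood 1# (multiples-isNeighbourhood 1≉0))
      where
      near-1 : IsNeighbourhood 1# (λ z → 1# ∣ z - 1#) →
               ∃[ N ] (IsNonZeroIdealOf K 𝒪 N × (∀ {x} → x ∈ N → ¬ x + 1# ≈ 0# → x + 1# ∣ 1#))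
      near-1 (U , U-open , 1∈U , U⊆) = N , N-isIdeal , λ {x} x∈N x+1≉0 →
          inverse-∣ (x + 1#) x+1≉0 (U⊆ (W⊆U {x + 1# , x+1≉0} (N⊆ x∈N)))
        where
        preimage = inverse-continuous U U-open
        W = proj₁ preimage
        W-open = proj₁ (proj₂ preimage)
        U⊆W = proj₁ (proj₂ (proj₂ preimage))
        W⊆U = proj₂ (proj₂ (proj₂ preimage))

        1∈W : 1# ∈ W
        1∈W = U⊆W {1# , 1≉0} (resp-≈ U-open (sym inverse-1) 1∈U)

        basis = ideals-areBasis (λ z → z + 1# ∈ W)
          ((λ z → z + 1# ∈ W) , translate-open 1# W-open , resp-≈ W-open (sym (+-identityˡ 1#)) 1∈W , λ z∈ → z∈)
        N = proj₁ basis
        N-isIdeal = proj₁ (proj₂ basis)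
        N⊆ = proj₂ (proj₂ basis)

    -- The factor `s` makes sk a non-unit, so that 1 + qsk is never 0; the factor `k` keeps qsk in
    -- the ideal `N`, where `near-1` then inverts 1 + qsk.
    infinitesimallyInvertible : ∃ InfinitesimallyInvertible
    infinitesimallyInvertible = s * k , xy≉0 s≉0 k≉0 , sk∤1 , λ q∈O →
        let qsk∈N = nonZeroIdeal-*-closed N-isIdeal q∈O (nonZeroIdeal-*-closed N-isIdeal s∈O k∈N)
        in near-1 qsk∈N (qsk+1≉0 q∈O) , 𝒪.+-closed (nonZeroIdeal⊆O N-isIdeal qsk∈N) 𝒪.1∈
      where
      N = proj₁ inverses-near-1
      N-isIdeal = proj₁ (proj₂ inverses-near-1)
      near-1 = proj₂ (proj₂ inverses-near-1)
      k = proj₁ (IsNonZeroIdealOf.nonZero N-isIdeal)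
      k∈N = proj₁ (proj₂ (IsNonZeroIdealOf.nonZero N-isIdeal))
      k≉0 = proj₂ (proj₂ (IsNonZeroIdealOf.nonZero N-isIdeal))

      sk∤1 : ¬ s * k ∣ 1#
      sk∤1 sk∣1 = s∤1 (∣-trans (k , nonZeroIdeal⊆O N-isIdeal k∈N , *-comm k s) sk∣1)

      qsk+1≉0 : ∀ {q} → q ∈ O → ¬ q * (s * k) + 1# ≈ 0#
      -- Otherwise `- q` would be an inverse of sk in `𝒪`.
      qsk+1≉0 {q} q∈O qsk+1≈0 = sk∤1 (- q , 𝒪.-‿closed q∈O ,
        trans (sym (-‿distribˡ-* q (s * k))) (sym (inverseʳ-unique _ 1# qsk+1≈0)))

    -- Here x′ = (1 + qj)x, and 1 + qj is a unit of `𝒪`.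
    associate-nearby : ∀ {x x′ j} → InfinitesimallyInvertible j → x * j ∣ x′ - x → x ∣ x′ × x′ ∣ x
    associate-nearby {x} {x′} {j} (_ , _ , invertible) (q , q∈O , qxj≈) =
      let (v , v∈O , v[qj+1]≈1) , qj+1∈O = invertible q∈O
      in (q * j + 1# , qj+1∈O , [qj+1]x≈x′) , v , v∈O , (begin
        v * x′                   ≈⟨ *-congˡ [qj+1]x≈x′ ⟨
        v * ((q * j + 1#) * x)   ≈⟨ *-assoc _ _ _ ⟨
        v * (q * j + 1#) * x     ≈⟨ *-congʳ v[qj+1]≈1 ⟩
        1# * x                   ≈⟨ *-identityˡ x ⟩
        x                        ∎)
      where
      [qj+1]x≈x′ : (q * j + 1#) * x ≈ x′
      [qj+1]x≈x′ = begin
        (q * j + 1#) * x    ≈⟨ solve 3 (λ q j x → (q :* j :+ con 1) :* x := q :* (x :* j) :+ x) refl q j x ⟩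
        q * (x * j) + x     ≈⟨ +-congʳ qxj≈ ⟩
        x′ - x + x          ≈⟨ //-rightDividesˡ x x′ ⟩
        x′                  ∎

    -- Local constancy of divisibility away from the origin.

    square : Topology (setoid ×ₛ setoid)
    square = productTopology topology topology

    -- The condition that `productTopology` imposes on an open set at a single point; isolating it
    -- lets continuity be argued point by point.
    Nearby : Carrier × Carrier → Pred (Carrier × Carrier) ℓ → Set (lsuc ℓ)
    Nearby p Q = ∃₂ λ V W → IsOpen V × IsOpen W × p ∈ (V ⟨×⟩ W) × (V ⟨×⟩ W) ⊆ Q

    nearby-⟨×⟩ : ∀ {x y M N} {Q : Pred (Carrier × Carrier) ℓ} → IsNeighbourhood x M → IsNeighbourhood y N →
                 (∀ {x′ y′} → x′ ∈ M → y′ ∈ N → (x′ , y′) ∈ Q) → Nearby (x , y) Q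
    nearby-⟨×⟩ (V , V-open , x∈V , V⊆M) (W , W-open , y∈W , W⊆N) ⊆Q =
      V , W , V-open , W-open , (x∈V , y∈W) , λ (x′∈V , y′∈W) → ⊆Q (V⊆M x′∈V) (W⊆N y′∈W)

    nearby-∩ : ∀ {p} {P Q S : Pred (Carrier × Carrier) ℓ} → Nearby p P → Nearby p Q →
               (∀ {q} → q ∈ P → q ∈ Q → q ∈ S) → Nearby p S
    nearby-∩ (V , W , oV , oW , (p∈V , p∈W) , ⊆P) (V′ , W′ , oV′ , oW′ , (p∈V′ , p∈W′) , ⊆Q) ⊆S =
      _ , _ , ∩-open oV oV′ , ∩-open oW oW′ , ((p∈V , p∈V′) , (p∈W , p∈W′))
        , λ ((q∈V , q∈V′) , (q∈W , q∈W′)) → ⊆S (⊆P (q∈V , q∈W)) (⊆Q (q∈V′ , q∈W′))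

    ∣-LocallyConstantAt : Carrier → Carrier → Set (lsuc ℓ)
    ∣-LocallyConstantAt x y = Nearby (x , y) (λ (x′ , y′) → x ∣ y ⇔ x′ ∣ y′)

    module _ {j : Carrier} (j-inv : InfinitesimallyInvertible j) where
      private
        j≉0 = proj₁ j-inv
        j∤1 = proj₁ (proj₂ j-inv)

      -- Moving x within x + xj𝒪 replaces it by an associate, and moving y within y + x𝒪 keeps its
      -- class modulo x𝒪.
      ∣-locallyConstant-x≉0 : ∀ {x} y → ¬ x ≈ 0# → ∣-LocallyConstantAt x y
      ∣-locallyConstant-x≉0 {x} y x≉0 = nearby-⟨×⟩
        (translate-neighbourhood x (multiples-isNeighbourhood (xy≉0 x≉0 j≉0)))
        (translate-neighbourhood y (multiples-isNeighbourhood x≉0))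
        (λ x′∈M y′∈N → constant (associate-nearby j-inv x′∈M) (x∣z-y⇒x∣y⇔x∣z y′∈N))
        where
        constant : ∀ {x′ y′} → x ∣ x′ × x′ ∣ x → x ∣ y ⇔ x ∣ y′ → x ∣ y ⇔ x′ ∣ y′
        constant (x∣x′ , x′∣x) equiv = mk⇔
          (λ x∣y → ∣-trans x′∣x (Equivalence.to equiv x∣y))
          (λ x′∣y′ → Equivalence.from equiv (∣-trans x∣x′ x′∣y′))

      yj∤y : ∀ {y} → ¬ y ≈ 0# → ¬ y * j ∣ y
      yj∤y {y} y≉0 (q , q∈O , qyj≈y) = j∤1 (q , q∈O , x∙y⁻¹≈ε⇒x≈y _ _ (xy≈0⇒y≈0 y≉0 (begin
        y * (q * j - 1#)         ≈⟨ x[y-z]≈xy-xz y (q * j) 1# ⟩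
        y * (q * j) - y * 1#     ≈⟨ +-cong (solve 3 (λ y q j → y :* (q :* j) := q :* (y :* j)) refl y q j) (-‿cong (*-identityʳ y)) ⟩
        q * (y * j) - y          ≈⟨ x≈y⇒x∙y⁻¹≈ε qyj≈y ⟩
        0#                       ∎)))

      -- At (0, y) divisibility fails. It still fails for x′ ∈ yj𝒪 and y′ ∈ y + yj𝒪: since y′ is an
      -- associate of y, x′ ∣ y′ would give yj ∣ x′ ∣ y′ ∣ y, contrary to `yj∤y`.
      ∣-locallyConstant-x≈0 : ∀ {x y} → x ≈ 0# → ¬ y ≈ 0# → ∣-LocallyConstantAt x y
      ∣-locallyConstant-x≈0 {x} {y} x≈0 y≉0 = nearby-⟨×⟩
        (translate-neighbourhood x (multiples-isNeighbourhood (xy≉0 y≉0 j≉0)))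
        (translate-neighbourhood y (multiples-isNeighbourhood (xy≉0 y≉0 j≉0)))
        (λ {x′} x′∈M y′∈N → mk⇔
            (λ (q , _ , qx≈y) → contradiction (trans (sym qx≈y) (trans (*-congˡ x≈0) (zeroʳ q))) y≉0)
            (λ x′∣y′ → contradiction
              (∣-trans (∣-resp refl (x-0≈x x′) x′∈M) (∣-trans x′∣y′ (proj₂ (associate-nearby j-inv y′∈N))))
              (yj∤y y≉0)))
        where
        x-0≈x : ∀ z → z - x ≈ z
        x-0≈x z = trans (+-congˡ (trans (-‿cong x≈0) ε⁻¹≈ε)) (+-identityʳ z)

    ∣-locallyConstant : ∀ x y → ¬ (x ≈ 0# × y ≈ 0#) → ∣-LocallyConstantAt x y
    ∣-locallyConstant x y ≉0 with lem {P = x ≈ 0#}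
    ... | no  x≉0 = ∣-locallyConstant-x≉0 (proj₂ infinitesimallyInvertible) y x≉0
    ... | yes x≈0 = ∣-locallyConstant-x≈0 (proj₂ infinitesimallyInvertible) x≈0 λ y≈0 → ≉0 (x≈0 , y≈0)

    -- Functions defined by cases on divisibility.

    open Semantics K {S = ⊤} (const O)

    module _ (u v : Func (setoid ×ₛ setoid) setoid) where
      private
        module u = Func u
        module v = Func v

      piecewise : Carrier × Carrier → Carrier
      piecewise p with lem {P = proj₁ p ∣ proj₂ p}
      ... | yes _ = u.to p
      ... | no  _ = v.to p

      piecewise-∣ : ∀ {p} → proj₁ p ∣ proj₂ p → piecewise p ≈ u.to p
      piecewise-∣ {p} p∣ with lem {P = proj₁ p ∣ proj₂ p}
      ... | yes _  = refl
      ... | no  p∤ = contradiction p∣ p∤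

      piecewise-∤ : ∀ {p} → ¬ proj₁ p ∣ proj₂ p → piecewise p ≈ v.to p
      piecewise-∤ {p} p∤ with lem {P = proj₁ p ∣ proj₂ p}
      ... | yes p∣ = contradiction p∣ p∤
      ... | no  _  = refl

      piecewise-cong : ∀ {p q} → proj₁ p ≈ proj₁ q × proj₂ p ≈ proj₂ q → piecewise p ≈ piecewise q
      piecewise-cong {p} p≈q@(p₁≈ , p₂≈) with lem {P = proj₁ p ∣ proj₂ p}
      ... | yes p∣ = trans (u.cong p≈q) (sym (piecewise-∣ (∣-resp p₁≈ p₂≈ p∣)))
      ... | no  p∤ = trans (v.cong p≈q) (sym (piecewise-∤ λ q∣ → p∤ (∣-resp (sym p₁≈) (sym p₂≈) q∣)))

      piecewiseFunc : Func (setoid ×ₛ setoid) setoid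
      piecewiseFunc = record { to = piecewise ; cong = piecewise-cong }

      module _ (u-continuous : Continuous square topology u.to) (v-continuous : Continuous square topology v.to)
               (u≈v-at-0 : ∀ {x y} → x ≈ 0# → y ≈ 0# → u.to (x , y) ≈ v.to (x , y)) where

        -- Away from the origin the choice of branch is locally constant, so only one of `u` and `v`
        -- matters. At the origin their values agree, so nearby both stay in `V`, whichever branch
        -- is taken.
        piecewise-continuous : Continuous square topology piecewise
        piecewise-continuous V V-open p@(x , y) wp∈V = near (lem {P = x ≈ 0# × y ≈ 0#}) (lem {P = x ∣ y})
          where
          V-resp : V Respects _≈_
          V-resp = resp-≈ V-open

          nearby-u : u.to p ∈ V → Nearby p (λ q → u.to q ∈ V)
          nearby-u = u-continuous V V-open p

          nearby-v : v.to p ∈ V → Nearby p (λ q → v.to q ∈ V)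
          nearby-v = v-continuous V V-open p

          piecewise∈V : ∀ {q} → u.to q ∈ V → v.to q ∈ V → piecewise q ∈ V
          piecewise∈V {q} uq∈V vq∈V with lem {P = proj₁ q ∣ proj₂ q}
          ... | yes _ = uq∈V
          ... | no  _ = vq∈V

          near : Dec (x ≈ 0# × y ≈ 0#) → Dec (x ∣ y) → Nearby p (λ q → piecewise q ∈ V)
          near (yes (x≈0 , y≈0)) (yes x∣y) =
            let up∈V = V-resp (piecewise-∣ x∣y) wp∈V
            in nearby-∩ (nearby-u up∈V) (nearby-v (V-resp (u≈v-at-0 x≈0 y≈0) up∈V)) piecewise∈V
          near (yes (x≈0 , y≈0)) (no x∤y) =
            let vp∈V = V-resp (piecewise-∤ x∤y) wp∈V
            in nearby-∩ (nearby-u (V-resp (sym (u≈v-at-0 x≈0 y≈0)) vp∈V)) (nearby-v vp∈V) piecewise∈V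
          near (no ≉0) (yes x∣y) = nearby-∩
            (∣-locallyConstant x y ≉0) (nearby-u (V-resp (piecewise-∣ x∣y) wp∈V))
            (λ equiv uq∈V → V-resp (sym (piecewise-∣ (Equivalence.to equiv x∣y))) uq∈V)
          near (no ≉0) (no x∤y) = nearby-∩
            (∣-locallyConstant x y ≉0) (nearby-v (V-resp (piecewise-∤ x∤y) wp∈V))
            (λ equiv vq∈V → V-resp (sym (piecewise-∤ (λ x′∣y′ → x∤y (Equivalence.from equiv x′∣y′)))) vq∈V)

      module _ (t t′ : Term 3)
               (t≈u : ∀ x y z → ⟦ t ⟧ (x ∷ y ∷ z ∷ []) ≈ u.to (x , y))
               (t′≈v : ∀ x y z → ⟦ t′ ⟧ (x ∷ y ∷ z ∷ []) ≈ v.to (x , y)) where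

        piecewise-definable : IsDefinable₂ K O piecewise
        piecewise-definable = 0 , graph , [] , λ x y z → mk⇔ (to x y z) (from x y z)
          where
          divides : Formula ⊤ 3
          -- Under the quantifier, variable 0 is the quotient, 1 is x and 2 is y; in `graph`,
          -- outside it, variable 2 is z.
          divides = ex (pred tt (var zero) ∧ var zero · var (suc zero) ≐̇ var (suc (suc zero)))

          graph : Formula ⊤ 3
          graph = divides ∧ t ≐̇ var (suc (suc zero)) ∨ (divides ⇒ false) ∧ t′ ≐̇ var (suc (suc zero))

          to : ∀ x y z → piecewise (x , y) ≈ z → Sat graph (x ∷ y ∷ z ∷ [])
          to x y z w≈z with lem {P = x ∣ y}
          ... | yes x∣y = inj₁ (x∣y , trans (t≈u x y z) w≈z)
          ... | no  x∤y = inj₂ ((λ x∣y → lift (x∤y x∣y)) , trans (t′≈v x y z) w≈z)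

          from : ∀ x y z → Sat graph (x ∷ y ∷ z ∷ []) → piecewise (x , y) ≈ z
          from x y z (inj₁ (x∣y , t≈z))  = trans (piecewise-∣ x∣y) (trans (sym (t≈u x y z)) t≈z)
          from x y z (inj₂ (x∤y , t′≈z)) =
            trans (piecewise-∤ (λ x∣y → lower (x∤y x∣y))) (trans (sym (t′≈v x y z)) t′≈z)

    -- The zero-detecting combination in case (c).

    first second zeroFunc : Func (setoid ×ₛ setoid) setoid
    first    = record { to = proj₁ ; cong = proj₁ }
    second   = record { to = proj₂ ; cong = proj₂ }
    zeroFunc = record { to = λ _ → 0# ; cong = λ _ → refl }

    first-continuous : Continuous square topology proj₁
    first-continuous V V-open p p∈ = V , _ , V-open , U-open , (p∈ , _) , proj₁

    second-continuous : Continuous square topology proj₂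
    second-continuous V V-open p p∈ = _ , V , U-open , V-open , (_ , p∈) , proj₂

    zero-continuous : Continuous square topology (λ _ → 0#)
    zero-continuous V V-open p 0∈V = _ , _ , U-open , U-open , _ , λ _ → 0∈V

    conditionC⇒zeroDetecting : ZeroDetecting A
    conditionC⇒zeroDetecting = record
      { α        = λ x y → piecewise first zeroFunc (x , y)
      ; β        = λ x y → piecewise zeroFunc second (x , y)
      ; α-closed = w-closed (piecewiseFunc first zeroFunc)
          (piecewise-continuous first zeroFunc first-continuous zero-continuous λ x≈0 _ → x≈0)
          (piecewise-definable first zeroFunc (var zero) 𝟎 (λ _ _ _ → refl) (λ _ _ _ → refl))
      ; β-closed = w-closed (piecewiseFunc zeroFunc second)
          (piecewise-continuous zeroFunc second zero-continuous second-continuous λ _ y≈0 → sym y≈0)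
          (piecewise-definable zeroFunc second 𝟎 (var (suc zero)) (λ _ _ _ → refl) (λ _ _ _ → refl))
      ; detects  = detects
      }
      where
      -- The combination is x² if x ∣ y and y² otherwise. In the first case x = 0 forces its
      -- multiple y to vanish; in the second y = 0 would be divisible by x after all.
      detects : ∀ x y → piecewise first zeroFunc (x , y) * x + piecewise zeroFunc second (x , y) * y ≈ 0# →
                x ≈ 0# × y ≈ 0#
      detects x y eq with lem {P = x ∣ y}
      ... | yes (q , _ , qx≈y) =
        let x≈0 = x*x≈0⇒x≈0 (trans (solve 2 (λ x y → x :* x := x :* x :+ con 0 :* y) refl x y) eq)
        in x≈0 , trans (sym qx≈y) (trans (*-congˡ x≈0) (zeroʳ q))
      ... | no  x∤y =
        let y≈0 = x*x≈0⇒x≈0 (trans (solve 2 (λ x y → y :* y := con 0 :* x :+ y :* y) refl x y) eq)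
        in contradiction (0# , 𝒪.0∈ , trans (zeroˡ x) (sym y≈0)) x∤y

-- The equivalences and the definability of inclusion of zero sets.

theorem3p4 : {ℓ : Level} → ExcludedMiddle (lsuc ℓ) →
    (K : CommutativeRing ℓ ℓ) (K-isField : IsField K) (X : Set ℓ) (A : FunctionRing K X) →
    ContainsConstants K X A →
    ZeroFreeAreUnits K X A →
    ConditionA K X A ⊎ ConditionB K X A ⊎ ConditionC K X A K-isField →
    let R = Subring.commutativeRing A
        open CommutativeRing R
    in
    ((n : ℕ) (f : Vector Carrier n) (g : Carrier) →
      (ZerosIncluded K X A f g ⇔ g ∈ Jac R (⟨_⟩ R f)) ×
      (g ∈ Jac R (⟨_⟩ R f) ⇔ ((h : Carrier) → IsUnitModulo R (⟨_⟩ R f) (1# + h * g)))) ×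
    ((n : ℕ) (f : Vector Carrier n) (g : Carrier) →
      (R ⊨ jacFormula n [ g ∷ f ]) ⇔ ZerosIncluded K X A f g) ×
    0-Definable₂ R (_⊑_ K X A)
theorem3p4 {ℓ} em K K-isField X A constants units condition =
    (λ n f g → mk⇔ (1⇒2 f g) (2⇒1 f g) , mk⇔ (2⇒3 f g) (3⇒2 f g))
  , (λ n f g → mk⇔ (formula⇒1 f g) (1⇒formula f g))
  , ⊑-formula
  , λ f g → mk⇔ (formula⇒⊑ f g) (⊑⇒formula f g)
  where
  lem : ExcludedMiddle ℓ
  -- Excluded middle descends to level `ℓ` by lifting each proposition to `lsuc ℓ`.
  lem = map′ lower lift em

  R = Subring.commutativeRing A
  open CommutativeRing R using (Carrier)
  open FieldFacts K K-isField lem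
  open RingFacts R using (UnitsModulo; unitsModulo⇒∈Jac; jacFormula⇔unitsModulo)

  zeroDetecting : ConditionA K X A ⊎ ConditionB K X A ⊎ ConditionC K X A K-isField → ZeroDetecting A
  zeroDetecting (inj₁ a)        = conditionA⇒zeroDetecting A constants a
  zeroDetecting (inj₂ (inj₁ b)) = conditionB⇒zeroDetecting K K-isField lem A b
  zeroDetecting (inj₂ (inj₂ c)) = conditionC⇒zeroDetecting K K-isField lem A c

  module _ {n : ℕ} (f : Vector Carrier n) (g : Carrier) where
    1⇒3 : ZerosIncluded K X A f g → UnitsModulo f g
    1⇒3 = zerosIncluded⇒unitsModulo A constants units (zeroDetecting condition) f g

    3⇒2 : UnitsModulo f g → g ∈ Jac R (⟨_⟩ R f)
    3⇒2 = unitsModulo⇒∈Jac lem f g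

    1⇒2 : ZerosIncluded K X A f g → g ∈ Jac R (⟨_⟩ R f)
    1⇒2 included = 3⇒2 (1⇒3 included)

    2⇒1 : g ∈ Jac R (⟨_⟩ R f) → ZerosIncluded K X A f g
    2⇒1 g∈Jac {x} f≈0 = ∈Jac⇒vanishing A constants x f g f≈0 g∈Jac

    2⇒3 : g ∈ Jac R (⟨_⟩ R f) → UnitsModulo f g
    -- The direct route would place a proper ideal inside a maximal one; passing through (1) avoids
    -- this.
    2⇒3 g∈Jac = 1⇒3 (2⇒1 g∈Jac)

    formula⇒1 : R ⊨ jacFormula n [ g ∷ f ] → ZerosIncluded K X A f g
    formula⇒1 sat = 2⇒1 (3⇒2 (Equivalence.to (jacFormula⇔unitsModulo _ n f g) sat))

    1⇒formula : ZerosIncluded K X A f g → R ⊨ jacFormula n [ g ∷ f ]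
    1⇒formula included = Equivalence.from (jacFormula⇔unitsModulo _ n f g) (1⇒3 included)

  -- jacFormula 1 with its two free variables interchanged.
  ⊑-formula : RingFormula 2
  ⊑-formula = all (ex (ex ((𝟏 ⊕ var (suc (suc zero)) · var (suc (suc (suc (suc zero))))) · var zero
                            ≐̇ 𝟏 ⊕ var (suc zero) · var (suc (suc (suc zero))))))

  module _ (f g : Carrier) where
    formula⇒⊑ : R ⊨ ⊑-formula [ f ∷ g ∷ [] ] → _⊑_ K X A f g
    -- Swapping the variables together with the entries of the environment leaves the evaluated
    -- equation unchanged, so `sat` serves for `jacFormula 1` as it stands.
    formula⇒⊑ sat fx≈0 = formula⇒1 (f ∷ []) g sat λ { zero → fx≈0 }

    ⊑⇒formula : _⊑_ K X A f g → R ⊨ ⊑-formula [ f ∷ g ∷ [] ]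
    ⊑⇒formula f⊑g = 1⇒formula (f ∷ []) g λ f≈0 → f⊑g (f≈0 zero)
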